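{- An exact (i.e., optimal) solution to $\textsc{Clique}$-$\textsc{Num}$ can be found in polynomial time on every class of graphs where a maximum-weight clique can be found in polynomial time.
   Context: An instance of $\textsc{Clique}$-$\textsc{Num}$ consists of a loop-free connected undirected graph $G=(V(G),E(G))$ on $n$ vertices, a set $P=\{1,\dots,k\}$ of pebbles, and a function $\sigma:P\to V(G)$ assigning each pebble its start vertex ($\sigma$ need not be injective). A feasible solution is a function $\mu:P\to V(G)$ (not necessarily injective), giving the end vertex of each pebble, such that the image $\mu[P]$ induces a clique in $G$ (every two distinct vertices of $\mu[P]$ are adjacent). The measure to be minimized is the number of moved pebbles $\textsc{Num}(\mu)=|\{p\in P:\sigma(p)\neq\mu(p)\}|$. The maximum-weight clique problem asks, given a graph with non-negative integer vertex weights, for a clique maximizing the sum of the weights of its vertices; the hypothesis on a class of graphs is that this can be done in polynomial time for graphs of the class with arbitrary such vertex weights. -}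

module Defs where

open import Data.Bool.Base using (Bool; false; T; if_then_else_)
open import Data.Fin.Base using (Fin; zero; toℕ)
open import Data.Fin.Properties using (_≟_)
open import Data.Fin.Subset using (Subset; _∈_)
open import Data.Fin.Subset.Properties using (_∈?_)
open import Data.List.Base using (List; []; _∷_; [_]; _++_; allFin; concatMap; drop; filter; head; length; map; replicate)
open import Data.Maybe.Base using (Maybe)
open import Data.Nat.Base using (ℕ; zero; suc; _+_; _*_; _^_; _≤_)
open import Data.Nat.ListAction using (sum)
open import Data.Product.Base using (Σ-syntax; ∃-syntax; _×_)
open import Data.Vec.Base as Vec using (Vec; _∷_; lookup; _[_]≔_)
open import Level using (Level; 0ℓ)
open import Relation.Binary.Construct.Closure.ReflexiveTransitive using (Star)
open import Relation.Binary.PropositionalEquality.Core using (_≡_; _≢_)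
open import Relation.Nullary.Decidable using (¬?)
open import Relation.Unary using (Pred)

private
  variable
    ℓ : Level
    n : ℕ

record Graph : Set where
  field
    order    : ℕ
    adjacent : Fin order → Fin order → Bool
    sym      : ∀ u v → adjacent u v ≡ adjacent v u
    loopless : ∀ v → adjacent v v ≡ false

  Vertex : Set
  Vertex = Fin order

  Adjacent : Vertex → Vertex → Set
  Adjacent u v = T (adjacent u v)

  Connected : Set
  Connected = ∀ u v → Star Adjacent u v

  IsClique : Pred (Pred Vertex 0ℓ) 0ℓ
  IsClique K = ∀ {u v} → K u → K v → u ≢ v → Adjacent u v

open Graph

record WeightedGraph : Set where
  field
    graph  : Graph
    weight : Vertex graph → ℕ

  totalWeight : Subset (order graph) → ℕ
  totalWeight K = sum (map weight (filter (_∈? K) (allFin (order graph))))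

  IsMaximumWeightClique : Subset (order graph) → Set
  IsMaximumWeightClique K =
    IsClique graph (_∈ K) ×
    (∀ K′ → IsClique graph (_∈ K′) → totalWeight K′ ≤ totalWeight K)

record PebbleInstance : Set where
  field
    graph     : Graph
    connected : Connected graph
    pebbles   : ℕ
    σ         : Fin pebbles → Vertex graph

  Placement : Set
  Placement = Fin pebbles → Vertex graph

  Image : Placement → Pred (Vertex graph) 0ℓ
  Image μ v = ∃[ p ] μ p ≡ v

  Feasible : Placement → Set
  Feasible μ = IsClique graph (Image μ)

  Num : Placement → ℕ
  Num μ = length (filter (λ p → ¬? (σ p ≟ μ p)) (allFin pebbles))

  IsOptimal : Placement → Set
  IsOptimal μ = Feasible μ × (∀ μ′ → Feasible μ′ → Num μ ≤ Num μ′)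

-- Deterministic multi-stack machines: the finite control is a structured program over a fixed number of
-- stacks of symbols, and every primitive action costs one step.  A stack
-- is half of a Turing machine tape, and a finite control state can be kept
-- on a stack, so such machines and deterministic multi-tape Turing
-- machines simulate each other with constant-factor overhead.

data Symbol : Set where
  𝟎 𝟏 comma semicolon : Symbol

Stack : Set
Stack = List Symbol

Store : ℕ → Set
Store = Vec Stack

-- `pop s k` removes the top symbol of stack s and continues with the branch
-- of k for that symbol; on an empty stack it takes the branch `nothing`.
-- `while s c` repeats c for as long as stack s is non-empty.
infixr 5 _⨾_

data Program (n : ℕ) : Set where
  skip  : Program n
  push  : Fin n → Symbol → Program n
  pop   : Fin n → (Maybe Symbol → Program n) → Program n
  _⨾_   : Program n → Program n → Program n
  while : Fin n → Program n → Program n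

-- `c ⊢ ρ ⇓[ t ] ρ′`: started in store ρ, program c halts after t steps in
-- store ρ′.
infix 4 _⊢_⇓[_]_

data _⊢_⇓[_]_ {n : ℕ} : Program n → Store n → ℕ → Store n → Set where

  skip : ∀ {ρ} → skip ⊢ ρ ⇓[ 1 ] ρ

  push : ∀ {s a ρ} → push s a ⊢ ρ ⇓[ 1 ] ρ [ s ]≔ (a ∷ lookup ρ s)

  pop : ∀ {s k ρ t ρ′} →
        k (head (lookup ρ s)) ⊢ ρ [ s ]≔ drop 1 (lookup ρ s) ⇓[ t ] ρ′ →
        pop s k ⊢ ρ ⇓[ suc t ] ρ′

  _⨾_ : ∀ {c₁ c₂ ρ t₁ ρ₁ t₂ ρ₂} →
        c₁ ⊢ ρ ⇓[ t₁ ] ρ₁ →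
        c₂ ⊢ ρ₁ ⇓[ t₂ ] ρ₂ →
        c₁ ⨾ c₂ ⊢ ρ ⇓[ t₁ + t₂ ] ρ₂

  while-stop : ∀ {s c ρ} →
               lookup ρ s ≡ [] →
               while s c ⊢ ρ ⇓[ 1 ] ρ

  while-step : ∀ {s c ρ t₁ ρ₁ t₂ ρ₂} →
               lookup ρ s ≢ [] →
               c ⊢ ρ ⇓[ t₁ ] ρ₁ →
               while s c ⊢ ρ₁ ⇓[ t₂ ] ρ₂ →
               while s c ⊢ ρ ⇓[ suc (t₁ + t₂) ] ρ₂

-- Input and output are on stack 0, first symbol on top.  All other stacks
-- start empty, and their final contents are ignored.
initial : List Symbol → Store (suc n)
initial w = w ∷ Vec.replicate _ []

output : Store (suc n) → List Symbol
output ρ = lookup ρ zero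

record SearchProblem : Set₁ where
  field
    Instance       : Set
    Solution       : Instance → Set
    Solves         : ∀ x → Solution x → Set
    encode         : Instance → List Symbol
    encodeSolution : ∀ x → Solution x → List Symbol

PolynomialTimeOn : (Π : SearchProblem) → Pred (SearchProblem.Instance Π) ℓ → Set ℓ
PolynomialTimeOn Π D =
  ∃[ k ] Σ[ c ∈ Program (suc k) ] ∃[ a ] ∃[ d ]
    (∀ x → D x →
      ∃[ y ] Solves x y ×
      (∃[ t ] ∃[ ρ ]
        c ⊢ initial (encode x) ⇓[ t ] ρ ×
        output ρ ≡ encodeSolution x y ×
        t ≤ a * length (encode x) ^ d + a))
  where open SearchProblem Π

encodeList : ∀ {A : Set} → (A → List Symbol) → List A → List Symbol
encodeList enc xs = concatMap (λ x → enc x ++ [ comma ]) xs ++ [ semicolon ]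

encodeBit : Bool → Symbol
encodeBit b = if b then 𝟏 else 𝟎

-- Binary numerals, least significant bit first, without leading zeros.
increment : List Symbol → List Symbol
increment (𝟎 ∷ w) = 𝟏 ∷ w
increment (𝟏 ∷ w) = 𝟎 ∷ increment w
increment _       = [ 𝟏 ]

binary : ℕ → List Symbol
binary zero    = []
binary (suc m) = increment (binary m)

-- Unary vertex names are harmless for polynomial time: an instance already
-- contains an adjacency matrix, whose size exceeds every vertex name.
encodeVertex : Fin n → List Symbol
encodeVertex v = replicate (toℕ v) 𝟏

encodeGraph : Graph → List Symbol
encodeGraph G = encodeList row (allFin (order G))
  where
  row : Vertex G → List Symbol
  row u = map (λ v → encodeBit (adjacent G u v)) (allFin (order G))

encodeSubset : Subset n → List Symbol
encodeSubset K = map encodeBit (Vec.toList K)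

encodeWeightedGraph : WeightedGraph → List Symbol
encodeWeightedGraph W =
  encodeGraph graph ++
  encodeList (λ v → binary (weight v)) (allFin (order graph))
  where open WeightedGraph W

encodePebbleInstance : PebbleInstance → List Symbol
encodePebbleInstance I =
  encodeGraph graph ++
  encodeList (λ p → encodeVertex (σ p)) (allFin pebbles)
  where open PebbleInstance I

MaximumWeightClique : SearchProblem
MaximumWeightClique = record
  { Instance       = WeightedGraph
  ; Solution       = λ W → Subset (order (WeightedGraph.graph W))
  ; Solves         = WeightedGraph.IsMaximumWeightClique
  ; encode         = encodeWeightedGraph
  ; encodeSolution = λ _ → encodeSubset
  }

CliqueNum : SearchProblem
CliqueNum = record
  { Instance       = PebbleInstance
  ; Solution       = PebbleInstance.Placement
  ; Solves         = PebbleInstance.IsOptimal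
  ; encode         = encodePebbleInstance
  ; encodeSolution = λ I μ →
      encodeList (λ p → encodeVertex (μ p)) (allFin (PebbleInstance.pebbles I))
  }

{-# OPTIONS --safe #-}
module Submission where

-- Let the weight of a vertex be the number of pebbles starting on it.  The
-- pebbles that a feasible μ leaves in place start in the clique μ[P], so
-- their number is at most the weight of that clique.  A maximum-weight
-- clique K therefore yields an optimum: keep the pebbles that start in K and
-- send all others to the first vertex of K, which exists as soon as there is
-- a pebble because the singleton of its start vertex has positive weight.
-- On the machine the weights come from n passes over the unary list of start
-- vertices, each of which counts and deletes the zeros and decrements the
-- other entries: the zeros found by pass v are the pebbles on vertex v.

open import Defs
open import Data.Bool.Base using (Bool; true; false; if_then_else_)
open import Data.Fin.Base using (Fin; zero; suc; toℕ)
open import Data.Fin.Properties using (_≟_; any?; toℕ≤n)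
open import Data.Fin.Subset using (Subset; _∈_; ⁅_⁆; Nonempty)
open import Data.Fin.Subset.Properties using (_∈?_; nonempty?; x∈⁅x⁆; x∈⁅y⁆⇒x≡y)
open import Data.List.Base
  using (List; []; _∷_; [_]; _++_; _ʳ++_; allFin; concatMap; drop; filter; foldl; head; length; map; replicate; tabulate)
open import Data.List.Membership.Propositional using (lose)
open import Data.List.Membership.Propositional.Properties using (∈-allFin)
open import Data.List.Properties
open import Data.List.Relation.Unary.All using (All; []; _∷_; universal)
open import Data.Maybe.Base using (just; maybe)
open import Data.Nat.Base using (ℕ; zero; suc; _+_; _*_; _^_; _≤_; z≤n; s≤s)
open import Data.Nat.ListAction using (sum)
open import Data.Nat.Properties hiding (_≟_)
open import Data.Product.Base using (∃-syntax; _×_; _,_; proj₁; proj₂)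
open import Data.Unit.Base using (⊤; tt)
open import Data.Vec.Base as Vec using (Vec; []; _∷_; here; lookup; there; _[_]≔_)
open import Data.Vec.Properties
  using ([]=⇒lookup; []≔-commutes; []≔-idempotent; []≔-lookup; lookup⇒[]=; lookup∘tabulate; lookup∘update; lookup∘update′)
open import Function.Base using (flip)
open import Level using (Level; 0ℓ)
open import Relation.Binary.PropositionalEquality hiding ([_])
open import Relation.Nullary using (¬_; contradiction; does; no; yes)
open import Relation.Nullary.Decidable using (True; dec-true; toWitness; ¬?)
open import Relation.Unary using (Decidable; Pred)

-- The solver expects every stack but its input stack to be empty and may leave anything behind. It
-- therefore runs unchanged on stacks of its own, beyond the eight of the reduction, which writes
-- the weighted graph to the first of them. Scanning a stack destroys it and leaves the copy
-- reversed; hence `_ʳ++_` throughout and the moves that close most phases. Every loop is specified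
-- as a left fold of a pure step function, which splits each phase into a check per symbol and a
-- statement about lists. The time bounds compose because pebbles are listed one by one: no weight
-- exceeds the length of the input, so the solver's input has at most quadratic length and a
-- polynomial of that length is still a polynomial.

private
  variable
    A : Set
    k m m′ n v z t b b′ : ℕ
    p p₁ p₂ : Program n
    ρ ρ₁ ρ₂ ρ′ : Store n
    i r q s u c d xs : Stack

-- Polynomially bounded functions

-- The power of suc x, unlike that of x, is monotone in the degree even at
-- x = 0.
record Polynomial (f : ℕ → ℕ) : Set where
  constructor bound
  field
    coefficient degree : ℕ
    bounded            : ∀ x → f x ≤ coefficient * suc x ^ degree

const-polynomial : ∀ c → Polynomial (λ _ → c)
const-polynomial c = bound c 0 λ x → ≤-reflexive (sym (*-identityʳ c))

id-polynomial : Polynomial (λ x → x)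
id-polynomial = bound 1 1 λ x → begin
  x               ≤⟨ n≤1+n x ⟩
  suc x           ≡⟨ trans (*-identityˡ (suc x ^ 1)) (*-identityʳ (suc x)) ⟨
  1 * suc x ^ 1   ∎
  where open ≤-Reasoning

infixl 6 _+ₚ_
infixl 7 _*ₚ_

_+ₚ_ : ∀ {f g} → Polynomial f → Polynomial g → Polynomial (λ x → f x + g x)
_+ₚ_ {f} {g} (bound a d f≤) (bound b e g≤) = bound (a + b) (d + e) λ x → begin
  f x + g x                                    ≤⟨ +-mono-≤ (f≤ x) (g≤ x) ⟩
  a * suc x ^ d + b * suc x ^ e                ≤⟨ +-mono-≤ (*-monoʳ-≤ a (^-monoʳ-≤ (suc x) (m≤m+n d e)))
                                                            (*-monoʳ-≤ b (^-monoʳ-≤ (suc x) (m≤n+m e d))) ⟩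
  a * suc x ^ (d + e) + b * suc x ^ (d + e)    ≡⟨ *-distribʳ-+ (suc x ^ (d + e)) a b ⟨
  (a + b) * suc x ^ (d + e)                    ∎
  where open ≤-Reasoning

_*ₚ_ : ∀ {f g} → Polynomial f → Polynomial g → Polynomial (λ x → f x * g x)
_*ₚ_ {f} {g} (bound a d f≤) (bound b e g≤) = bound (a * b) (d + e) λ x → begin
  f x * g x                              ≤⟨ *-mono-≤ (f≤ x) (g≤ x) ⟩
  (a * suc x ^ d) * (b * suc x ^ e)      ≡⟨ [m*n]*[o*p]≡[m*o]*[n*p] a (suc x ^ d) b (suc x ^ e) ⟩
  (a * b) * (suc x ^ d * suc x ^ e)      ≡⟨ cong (a * b *_) (^-distribˡ-+-* (suc x) d e) ⟨
  (a * b) * suc x ^ (d + e)              ∎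
  where open ≤-Reasoning

_^ₚ_ : ∀ {f} → Polynomial f → ∀ d → Polynomial (λ x → f x ^ d)
f ^ₚ zero  = const-polynomial 1
f ^ₚ suc d = f *ₚ (f ^ₚ d)

-- For a positive base, its successor is at most its double, which gives the factor `2 ^ d`. At base
-- zero the left side is 1, which the summand 1 covers.
suc-^-≤ : ∀ x d → suc x ^ d ≤ 2 ^ d * x ^ d + 1
suc-^-≤ zero    d = ≤-trans (≤-reflexive (^-zeroˡ d)) (m≤n+m 1 (2 ^ d * 0 ^ d))
suc-^-≤ (suc x) d = ≤-trans (doubled d) (m≤m+n _ 1)
  where
  doubled : ∀ d → suc (suc x) ^ d ≤ 2 ^ d * suc x ^ d
  doubled zero    = ≤-refl
  doubled (suc d) = begin
    suc (suc x) * suc (suc x) ^ d           ≤⟨ *-mono-≤ (+-mono-≤ (s≤s (z≤n {x})) (m≤m+n (suc x) 0)) (doubled d) ⟩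
    2 * suc x * (2 ^ d * suc x ^ d)         ≡⟨ [m*n]*[o*p]≡[m*o]*[n*p] 2 (suc x) (2 ^ d) (suc x ^ d) ⟩
    2 * 2 ^ d * (suc x * suc x ^ d)         ∎
    where open ≤-Reasoning

polynomial-bound : ∀ {f} → Polynomial f → ∃[ a ] ∃[ d ] ∀ x → f x ≤ a * x ^ d + a
polynomial-bound {f} (bound a d f≤) = a * 2 ^ d , d , λ x → begin
  f x                                  ≤⟨ f≤ x ⟩
  a * suc x ^ d                        ≤⟨ *-monoʳ-≤ a (suc-^-≤ x d) ⟩
  a * (2 ^ d * x ^ d + 1)              ≡⟨ *-distribˡ-+ a (2 ^ d * x ^ d) 1 ⟩
  a * (2 ^ d * x ^ d) + a * 1          ≡⟨ cong (_+ a * 1) (*-assoc a (2 ^ d) (x ^ d)) ⟨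
  -- Enlarging the constant term lets one number serve as both coefficient and constant, as
  -- `PolynomialTimeOn` demands.
  a * 2 ^ d * x ^ d + a * 1            ≤⟨ +-monoʳ-≤ (a * 2 ^ d * x ^ d) (*-monoʳ-≤ a (m^n>0 2 d)) ⟩
  a * 2 ^ d * x ^ d + a * 2 ^ d        ∎
  where open ≤-Reasoning

-- Runs within a time bound

infix 4 _⊢_⇓≤[_]_

-- Exact running times depend on the symbols read. Keeping only an upper bound lets costs be
-- functions of input length alone, added along a sequence.
record _⊢_⇓≤[_]_ {n : ℕ} (c : Program n) (ρ : Store n) (b : ℕ) (ρ′ : Store n) : Set where
  constructor _within_
  field
    {time} : ℕ
    run    : c ⊢ ρ ⇓[ time ] ρ′
    time≤  : time ≤ b

-- For a straight-line run both numbers are closed, so the comparison is decided by evaluation and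
-- its proof is filled in automatically.
exactly : p ⊢ ρ ⇓[ t ] ρ′ → {True (t ≤? b)} → p ⊢ ρ ⇓≤[ b ] ρ′
exactly r {t≤b} = r within toWitness t≤b

weaken : b ≤ b′ → p ⊢ ρ ⇓≤[ b ] ρ′ → p ⊢ ρ ⇓≤[ b′ ] ρ′
weaken b≤b′ (r within t≤b) = r within ≤-trans t≤b b≤b′

infixr 5 _⨾≤_

_⨾≤_ : p₁ ⊢ ρ ⇓≤[ b ] ρ₁ → p₂ ⊢ ρ₁ ⇓≤[ b′ ] ρ₂ → p₁ ⨾ p₂ ⊢ ρ ⇓≤[ b + b′ ] ρ₂
(r₁ within t₁≤) ⨾≤ (r₂ within t₂≤) = (r₁ ⨾ r₂) within +-mono-≤ t₁≤ t₂≤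

push≤ : ∀ {s a} → push s a ⊢ ρ ⇓≤[ 1 ] ρ [ s ]≔ (a ∷ lookup ρ s)
push≤ = push within ≤-refl

pop≤ : ∀ {s k} → k (head (lookup ρ s)) ⊢ ρ [ s ]≔ drop 1 (lookup ρ s) ⇓≤[ b ] ρ′ →
       pop s k ⊢ ρ ⇓≤[ suc b ] ρ′
pop≤ (r within t≤) = pop r within s≤s t≤

pop-top : ∀ {s k x xs} → lookup ρ s ≡ x ∷ xs → ρ [ s ]≔ xs ≡ ρ₁ →
          k (just x) ⊢ ρ₁ ⇓[ t ] ρ′ → pop s k ⊢ ρ ⇓[ suc t ] ρ′
pop-top {ρ = ρ} {s = s} {k} top refl r =
  pop (subst (λ w → k (head w) ⊢ ρ [ s ]≔ drop 1 w ⇓[ _ ] _) (sym top) r)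

-- Loops that consume a stack

forEach : Fin n → (Symbol → Program n) → Program n
-- The default `skip` belongs to the empty stack, which the guard of `while` excludes.
forEach s k = while s (pop s (maybe k skip))

-- A round takes one step for the guard, one for the pop and at most `b` for the body; the outer
-- `suc` is the final test.
loopCost : ℕ → ℕ → ℕ
loopCost m b = suc (m * (2 + b))

loopCost-polynomial : ∀ {f g} → Polynomial f → Polynomial g → Polynomial (λ x → loopCost (f x) (g x))
loopCost-polynomial f g = const-polynomial 1 +ₚ f *ₚ (const-polynomial 2 +ₚ g)

-- The stack being read is overwritten with the unread symbols, and `ρ` gives the other stacks as a
-- function of an abstract state. `Inv` also sees the unread symbols, so it can bound a quantity
-- that grows as they are used up.
module _ {A : Set} {s : Fin n} {k : Symbol → Program n}
         (ρ : A → Store n) (step : A → Symbol → A) (Inv : A → List Symbol → Set)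
         (preserved : ∀ {a x xs} → Inv a (x ∷ xs) → Inv (step a x) xs)
         (body : ∀ {a x xs} → Inv a (x ∷ xs) → k x ⊢ ρ a [ s ]≔ xs ⇓≤[ b ] ρ (step a x) [ s ]≔ xs)
         where

  private
    loop : ∀ {a} xs → Inv a xs →
           forEach s k ⊢ ρ a [ s ]≔ xs ⇓≤[ loopCost (length xs) b ] ρ (foldl step a xs) [ s ]≔ []
    loop {a} []       inv = while-stop (lookup∘update s (ρ a) []) within ≤-refl
    loop {a} (x ∷ xs) inv with body inv | loop xs (preserved inv)
    ... | r within r≤ | rs within rs≤ =
      while-step nonempty (pop-top top ([]≔-idempotent (ρ a) s) r) rs within
      s≤s (≤-trans (+-mono-≤ (s≤s r≤) rs≤) (≤-reflexive (cong suc (+-suc b _))))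
      where
      top : lookup (ρ a [ s ]≔ (x ∷ xs)) s ≡ x ∷ xs
      top = lookup∘update s (ρ a) (x ∷ xs)

      nonempty : lookup (ρ a [ s ]≔ (x ∷ xs)) s ≢ []
      nonempty eq with () ← trans (sym top) eq

  forEach-run : ∀ {a a′ m} xs → Inv a xs → foldl step a xs ≡ a′ → length xs ≤ m →
                forEach s k ⊢ ρ a [ s ]≔ xs ⇓≤[ loopCost m b ] ρ a′ [ s ]≔ []
  forEach-run xs inv refl xs≤m = weaken (s≤s (*-monoˡ-≤ (2 + b) xs≤m)) (loop xs inv)

forEach-run′ : ∀ {A : Set} {s : Fin n} {k} (ρ : A → Store n) (step : A → Symbol → A) →
               (∀ a x xs → k x ⊢ ρ a [ s ]≔ xs ⇓≤[ b ] ρ (step a x) [ s ]≔ xs) →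
               ∀ {a a′ m} xs → foldl step a xs ≡ a′ → length xs ≤ m →
               forEach s k ⊢ ρ a [ s ]≔ xs ⇓≤[ loopCost m b ] ρ a′ [ s ]≔ []
forEach-run′ ρ step body xs =
  forEach-run ρ step (λ _ _ → ⊤) (λ _ → tt) (λ {a} {x} {xs} _ → body a x xs) xs tt

move : Fin n → Fin n → Program n
move s t = forEach s (push t)

move-run : ∀ {s t : Fin n} {m} → s ≢ t → (ρ : Store n) → length (lookup ρ s) ≤ m →
           move s t ⊢ ρ ⇓≤[ loopCost m 1 ] (ρ [ t ]≔ (lookup ρ s ʳ++ lookup ρ t)) [ s ]≔ []
move-run {n = n} {s = s} {t} {m} s≢t ρ ≤m =
  subst (λ ρ₁ → move s t ⊢ ρ₁ ⇓≤[ loopCost m 1 ] (ρ [ t ]≔ (lookup ρ s ʳ++ lookup ρ t)) [ s ]≔ []) start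
    (forEach-run′ (λ w → ρ [ t ]≔ w) (flip _∷_) body {lookup ρ t} (lookup ρ s) refl ≤m)
  where
  start : (ρ [ t ]≔ lookup ρ t) [ s ]≔ lookup ρ s ≡ ρ
  start = trans (cong (_[ s ]≔ lookup ρ s) ([]≔-lookup ρ t)) ([]≔-lookup ρ s)

  body : ∀ w x xs → push t x ⊢ (ρ [ t ]≔ w) [ s ]≔ xs ⇓≤[ 1 ] (ρ [ t ]≔ (x ∷ w)) [ s ]≔ xs
  body w x xs = subst (push t x ⊢ _ ⇓≤[ 1 ]_) pushed push≤
    where
    open ≡-Reasoning

    stacks : Store n
    stacks = (ρ [ t ]≔ w) [ s ]≔ xs

    below : lookup stacks t ≡ w
    below = trans (lookup∘update′ (≢-sym s≢t) (ρ [ t ]≔ w) xs) (lookup∘update t ρ w)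

    pushed : stacks [ t ]≔ (x ∷ lookup stacks t) ≡ (ρ [ t ]≔ (x ∷ w)) [ s ]≔ xs
    pushed = begin
      stacks [ t ]≔ (x ∷ lookup stacks t)               ≡⟨ cong (λ v → stacks [ t ]≔ (x ∷ v)) below ⟩
      stacks [ t ]≔ (x ∷ w)                         ≡⟨ []≔-commutes (ρ [ t ]≔ w) s t s≢t ⟩
      ((ρ [ t ]≔ w) [ t ]≔ (x ∷ w)) [ s ]≔ xs   ≡⟨ cong (_[ s ]≔ xs) ([]≔-idempotent ρ t) ⟩
      (ρ [ t ]≔ (x ∷ w)) [ s ]≔ xs              ∎

-- Scans leave their result reversed; one further move onto an empty stack reverses it a second
-- time.
restore-run : ∀ {n m} {s t : Fin n} → s ≢ t → ∀ xs (ρ : Store n) →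
              lookup ρ s ≡ xs ʳ++ [] → lookup ρ t ≡ [] → length xs ≤ m →
              move s t ⊢ ρ ⇓≤[ loopCost m 1 ] (ρ [ t ]≔ xs) [ s ]≔ []
restore-run {m = m} {s} {t} s≢t xs ρ s≡ t≡ xs≤m =
  subst (λ w → move s t ⊢ ρ ⇓≤[ loopCost m 1 ] (ρ [ t ]≔ w) [ s ]≔ []) moved
    (move-run s≢t ρ (subst (_≤ m) (sym (trans (cong length s≡) (trans (length-ʳ++ xs) (+-identityʳ _)))) xs≤m))
  where
  moved : lookup ρ s ʳ++ lookup ρ t ≡ xs
  moved rewrite s≡ | t≡ = trans (ʳ++-ʳ++ xs) (++-identityʳ xs)

-- Embedding a program among additional stacks

lift : Program n → Program (suc n)
lift skip        = skip
lift (push s a)  = push (suc s) a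
lift (pop s k)   = pop (suc s) (λ x → lift (k x))
lift (c₁ ⨾ c₂)   = lift c₁ ⨾ lift c₂
lift (while s c) = while (suc s) (lift c)

lift-run : ∀ {w} → p ⊢ ρ ⇓[ t ] ρ′ → lift p ⊢ w ∷ ρ ⇓[ t ] w ∷ ρ′
lift-run skip                   = skip
lift-run push                   = push
lift-run (pop r)                = pop (lift-run r)
lift-run (r₁ ⨾ r₂)              = lift-run r₁ ⨾ lift-run r₂
lift-run (while-stop eq)        = while-stop eq
lift-run (while-step neq r₁ r₂) = while-step neq (lift-run r₁) (lift-run r₂)

liftBy : ∀ m → Program n → Program (m + n)
liftBy zero    c = c
liftBy (suc m) c = lift (liftBy m c)

-- The additional stacks come first and are never touched. With eight of them the input stack of the
-- embedded program is `W`, and the saved pebbles survive its run.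
liftBy-run : ∀ {m} (ρ₀ : Store m) → p ⊢ ρ ⇓[ t ] ρ′ → liftBy m p ⊢ ρ₀ Vec.++ ρ ⇓[ t ] ρ₀ Vec.++ ρ′
liftBy-run []       r = r
liftBy-run (_ ∷ ρ₀) r = lift-run (liftBy-run ρ₀ r)

-- Computing the weights

-- I holds the input, then the pebbles still to be counted, and finally the
-- output; R collects lists in reverse; N is the number of vertices in unary;
-- S saves the start vertices; U counts in unary, and after the solver has run
-- it is the first vertex of the clique; C counts in binary; D is scratch
-- space; F is a flag; W and the stacks beyond it are those of the solver.
I R N S U C D F W : Fin (9 + k)
I = zero
R = suc zero
N = suc (suc zero)
S = suc (suc (suc zero))
U = suc (suc (suc (suc zero)))
C = suc (suc (suc (suc (suc zero))))
D = suc (suc (suc (suc (suc (suc zero)))))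
F = suc (suc (suc (suc (suc (suc (suc zero))))))
W = suc (suc (suc (suc (suc (suc (suc (suc zero)))))))

ifPop : Fin m → Program m → Program m → Program m
ifPop s p q = pop s (maybe (λ _ → p) q)

discard : Fin m → Program m
discard s = ifPop s skip skip

clear : Fin m → Program m
clear s = forEach s (λ _ → skip)

flag : Bool → Stack
flag b = if b then [ 𝟏 ] else []

ones : ℕ → Stack
ones n = replicate n 𝟏

-- Binary counter

data IsBit : Symbol → Set where
  𝟎 : IsBit 𝟎
  𝟏 : IsBit 𝟏

increment-bits : All IsBit xs → All IsBit (increment xs)
increment-bits []       = 𝟏 ∷ []
increment-bits (𝟎 ∷ bs) = 𝟏 ∷ bs
increment-bits (𝟏 ∷ bs) = 𝟎 ∷ increment-bits bs

binary-bits : ∀ v → All IsBit (binary v)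
binary-bits zero    = []
binary-bits (suc v) = increment-bits (binary-bits v)

length-increment : ∀ xs → length (increment xs) ≤ suc (length xs)
length-increment []               = ≤-refl
length-increment (𝟎 ∷ xs)         = n≤1+n _
length-increment (𝟏 ∷ xs)         = s≤s (length-increment xs)
length-increment (comma ∷ xs)     = s≤s z≤n
length-increment (semicolon ∷ xs) = s≤s z≤n

length-binary : ∀ v → length (binary v) ≤ v
length-binary zero    = z≤n
length-binary (suc v) = ≤-trans (length-increment (binary v)) (s≤s (length-binary v))

-- The Boolean is the pending carry, the stack the digits done, in reverse. A carry left at the end
-- becomes a new leading digit, which is the task of `settle`.
carryStep : Bool × Stack → Symbol → Bool × Stack
carryStep (true  , d) 𝟏 = true  , 𝟎 ∷ d
carryStep (true  , d) _ = false , 𝟏 ∷ d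
carryStep (false , d) x = false , x ∷ d

settle : Bool × Stack → Stack
settle (true  , d) = 𝟏 ∷ d
settle (false , d) = d

carry-false : ∀ xs → foldl carryStep (false , d) xs ≡ (false , xs ʳ++ d)
carry-false []       = refl
carry-false (_ ∷ xs) = carry-false xs

-- Up to the first 𝟎 the scan mirrors `increment`; after it nothing is carried and the rest is
-- copied. On a separator the two would part: `increment` drops what follows, the scan copies it.
carry-true : All IsBit xs → settle (foldl carryStep (true , d) xs) ≡ increment xs ʳ++ d
carry-true []                    = refl
carry-true {xs = _ ∷ xs} (𝟎 ∷ _) = cong settle (carry-false xs)
carry-true (𝟏 ∷ bs)              = carry-true bs

-- Testing `F` pops it, so a carry that persists has to be pushed again.
addCarry : Symbol → Program (9 + k)
addCarry 𝟏 = push D 𝟎 ⨾ push F 𝟏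
addCarry _ = push D 𝟏

incrementCounter : Program (9 + k)
incrementCounter =
  push F 𝟏 ⨾
  forEach C (λ x → ifPop F (addCarry x) (push D x)) ⨾
  ifPop F (push D 𝟏) skip ⨾
  move D C

incrementCost : ℕ → ℕ
-- The last loop allows for `suc m` symbols because the numeral may gain a digit.
incrementCost m = 1 + (loopCost m 3 + (2 + loopCost (suc m) 1))

incrementCounter-run : v ≤ m →
  incrementCounter ⊢ i ∷ r ∷ q ∷ s ∷ u ∷ binary v ∷ [] ∷ [] ∷ ρ ⇓≤[ incrementCost m ]
                     i ∷ r ∷ q ∷ s ∷ u ∷ binary (suc v) ∷ [] ∷ [] ∷ ρ
incrementCounter-run {v = v} {m} {i} {r} {q} {s} {u} {ρ = ρ} v≤m =
  push≤ ⨾≤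
  forEach-run′ scan carryStep body (binary v) refl (≤-trans (length-binary v) v≤m) ⨾≤
  settle-run (foldl carryStep (true , []) (binary v)) ⨾≤
  restore-run (λ ()) (binary (suc v)) _ (carry-true (binary-bits v)) refl
              (≤-trans (length-binary (suc v)) (s≤s v≤m))
  where
  scan : Bool × Stack → Store _
  scan (b , d) = i ∷ r ∷ q ∷ s ∷ u ∷ [] ∷ d ∷ flag b ∷ ρ

  body : ∀ a x xs → ifPop F (addCarry x) (push D x) ⊢ scan a [ C ]≔ xs ⇓≤[ 3 ] scan (carryStep a x) [ C ]≔ xs
  body (true  , d) 𝟎         xs = exactly (pop push)
  body (true  , d) 𝟏         xs = exactly (pop (push ⨾ push))
  body (true  , d) comma     xs = exactly (pop push)
  body (true  , d) semicolon xs = exactly (pop push)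
  body (false , d) x         xs = exactly (pop push)

  settle-run : ∀ a → ifPop F (push D 𝟏) skip ⊢ scan a ⇓≤[ 2 ] i ∷ r ∷ q ∷ s ∷ u ∷ [] ∷ settle a ∷ [] ∷ ρ
  settle-run (true  , d) = exactly (pop push)
  settle-run (false , d) = exactly (pop skip)

foldl-terminated : ∀ {A B : Set} (step : A → B → A) a xs x ys →
                   foldl step a ((xs ++ [ x ]) ++ ys) ≡ foldl step (step (foldl step a xs) x) ys
foldl-terminated step a xs x ys =
  trans (foldl-++ step a (xs ++ [ x ]) ys)
        (cong (λ a → foldl step a ys) (foldl-++ step a xs [ x ]))

terminated-ʳ++ : ∀ {A : Set} (xs : List A) x ys zs → ((xs ++ [ x ]) ++ ys) ʳ++ zs ≡ ys ʳ++ x ∷ xs ʳ++ zs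
terminated-ʳ++ xs x ys zs = foldl-terminated (flip _∷_) zs xs x ys

-- Counting and decrementing the entries of a unary list

unaries : List ℕ → Stack
unaries = concatMap (λ j → ones j ++ [ comma ])

zeros : List ℕ → ℕ
zeros []           = 0
zeros (zero ∷ js)  = suc (zeros js)
zeros (suc _ ∷ js) = zeros js

preds : List ℕ → List ℕ
preds []           = []
preds (zero ∷ js)  = preds js
preds (suc j ∷ js) = j ∷ preds js

zeros≤ : ∀ js → zeros js ≤ length (unaries js)
zeros≤ []           = z≤n
zeros≤ (zero ∷ js)  = s≤s (zeros≤ js)
zeros≤ (suc j ∷ js) = ≤-trans (zeros≤ js) (length-++-≤ʳ (unaries js) {ones (suc j) ++ [ comma ]})

length-preds : ∀ js → length (unaries (preds js)) ≤ length (unaries js)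
length-preds []           = z≤n
length-preds (zero ∷ js)  = m≤n⇒m≤1+n (length-preds js)
length-preds (suc j ∷ js) = begin
  length ((ones j ++ [ comma ]) ++ unaries (preds js))              ≡⟨ length-++ (ones j ++ [ comma ]) ⟩
  length (ones j ++ [ comma ]) + length (unaries (preds js))        ≤⟨ +-mono-≤ (n≤1+n _) (length-preds js) ⟩
  length (ones (suc j) ++ [ comma ]) + length (unaries js)          ≡⟨ length-++ (ones (suc j) ++ [ comma ]) ⟨
  length ((ones (suc j) ++ [ comma ]) ++ unaries js)                ∎
  where open ≤-Reasoning

-- The flag is set while nothing of the current entry has been read.
decrementStep : Bool × Stack × ℕ → Symbol → Bool × Stack × ℕ
decrementStep (true  , d , z) 𝟏     = false , d , z
decrementStep (false , d , z) 𝟏     = false , 𝟏 ∷ d , z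
decrementStep (true  , d , z) comma = true , d , suc z
decrementStep (false , d , z) comma = true , comma ∷ d , z
decrementStep a               _     = a

decrement-ones : ∀ j d z → foldl decrementStep (false , d , z) (ones j) ≡ (false , ones j ʳ++ d , z)
decrement-ones zero    d z = refl
decrement-ones (suc j) d z = decrement-ones j (𝟏 ∷ d) z

decrement-unaries : ∀ js d z → foldl decrementStep (true , d , z) (unaries js) ≡
                               (true , unaries (preds js) ʳ++ d , zeros js + z)
decrement-unaries []           d z = refl
decrement-unaries (zero ∷ js)  d z =
  trans (decrement-unaries js d (suc z)) (cong (λ y → true , unaries (preds js) ʳ++ d , y) (+-suc (zeros js) z))
decrement-unaries (suc j ∷ js) d z = begin
  foldl decrementStep (false , d , z) ((ones j ++ [ comma ]) ++ unaries js)
    ≡⟨ foldl-terminated decrementStep _ (ones j) comma (unaries js) ⟩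
  foldl decrementStep (decrementStep (foldl decrementStep (false , d , z) (ones j)) comma) (unaries js)
    ≡⟨ cong (λ a → foldl decrementStep (decrementStep a comma) (unaries js)) (decrement-ones j d z) ⟩
  foldl decrementStep (true , comma ∷ ones j ʳ++ d , z) (unaries js)
    ≡⟨ decrement-unaries js (comma ∷ ones j ʳ++ d) z ⟩
  (true , unaries (preds js) ʳ++ comma ∷ ones j ʳ++ d , zeros js + z)
    ≡⟨ cong (λ d → true , d , zeros js + z) (terminated-ʳ++ (ones j) comma (unaries (preds js)) d) ⟨
  (true , unaries (j ∷ preds js) ʳ++ d , zeros js + z)
    ∎
  where open ≡-Reasoning

-- Popping the flag is the decrement: the 𝟏 that finds it set is dropped. At a comma either branch
-- leaves `F` empty, so one push prepares it for the next entry.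
decrementSymbol : Symbol → Program (9 + k)
decrementSymbol 𝟏     = ifPop F skip (push D 𝟏)
decrementSymbol comma = ifPop F (push U 𝟏) (push D comma) ⨾ push F 𝟏
decrementSymbol _     = skip

decrementPebbles : Program (9 + k)
decrementPebbles = push F 𝟏 ⨾ forEach I decrementSymbol ⨾ discard F ⨾ move D I

decrementCost : ℕ → ℕ
decrementCost m = 1 + (loopCost m 3 + (2 + loopCost m 1))

decrementPebbles-run : ∀ js → length (unaries js) ≤ m →
  decrementPebbles ⊢ unaries js ∷ r ∷ q ∷ s ∷ [] ∷ c ∷ [] ∷ [] ∷ ρ ⇓≤[ decrementCost m ]
                     unaries (preds js) ∷ r ∷ q ∷ s ∷ ones (zeros js) ∷ c ∷ [] ∷ [] ∷ ρ
decrementPebbles-run {m} {r = r} {q} {s} {c} {ρ = ρ} js js≤m =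
  push≤ ⨾≤
  forEach-run′ scan decrementStep body (unaries js)
    (trans (decrement-unaries js [] 0) (cong (λ z → true , unaries (preds js) ʳ++ [] , z) (+-identityʳ (zeros js))))
    js≤m ⨾≤
  -- The scan ends at the start of an entry, hence with the flag set.
  exactly {b = 2} (pop skip) ⨾≤
  restore-run (λ ()) (unaries (preds js)) _ refl refl (≤-trans (length-preds js) js≤m)
  where
  scan : Bool × Stack × ℕ → Store _
  scan (b , d , z) = [] ∷ r ∷ q ∷ s ∷ ones z ∷ c ∷ d ∷ flag b ∷ ρ

  body : ∀ a x xs → decrementSymbol x ⊢ scan a [ I ]≔ xs ⇓≤[ 3 ] scan (decrementStep a x) [ I ]≔ xs
  body (true  , _) 𝟎         _ = exactly skip
  body (false , _) 𝟎         _ = exactly skip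
  body (true  , _) 𝟏         _ = exactly (pop skip)
  body (false , _) 𝟏         _ = exactly (pop push)
  body (true  , _) comma     _ = exactly (pop push ⨾ push)
  body (false , _) comma     _ = exactly (pop push ⨾ push)
  body (true  , _) semicolon _ = exactly skip
  body (false , _) semicolon _ = exactly skip

foldl-counts : ∀ {A : Set} z (xs : List A) → foldl (λ a _ → suc a) z xs ≡ length xs + z
foldl-counts z []       = refl
foldl-counts z (_ ∷ xs) = trans (foldl-counts (suc z) xs) (+-suc (length xs) z)

-- The zeros are first counted in unary on `U`, because incrementing the binary counter needs `D`
-- and `F`, which the scan of the pebbles occupies.
tallyVertex : Program (9 + k)
tallyVertex =
  decrementPebbles ⨾
  forEach U (λ _ → incrementCounter) ⨾
  move C R ⨾
  push R comma

tallyCost : ℕ → ℕ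
tallyCost m = decrementCost m + (loopCost m (incrementCost m) + (loopCost m 1 + 1))

tallyVertex-run : ∀ js → length (unaries js) ≤ m →
  tallyVertex ⊢ unaries js ∷ r ∷ q ∷ s ∷ [] ∷ [] ∷ [] ∷ [] ∷ ρ ⇓≤[ tallyCost m ]
                unaries (preds js) ∷ (comma ∷ binary (zeros js) ʳ++ r) ∷ q ∷ s ∷ [] ∷ [] ∷ [] ∷ [] ∷ ρ
tallyVertex-run {m} {r = r} {q} {s} {ρ = ρ} js js≤m =
  decrementPebbles-run js js≤m ⨾≤
  forEach-run (λ v → unaries (preds js) ∷ r ∷ q ∷ s ∷ [] ∷ binary v ∷ [] ∷ [] ∷ ρ) (λ v _ → suc v)
    -- Each round moves one unit from the unread count to the counter, so the sum is constant and
    -- bounds the counter at every increment.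
    (λ v xs → length xs + v ≤ m)
    (λ {v} {_} {xs} → subst (_≤ m) (sym (+-suc (length xs) v)))
    (λ {v} {_} {xs} xs+v≤m → incrementCounter-run (≤-trans (m≤n+m v (suc (length xs))) xs+v≤m))
    (ones (zeros js)) (subst (_≤ m) (sym (+-identityʳ _)) us≤m)
    (trans (foldl-counts 0 (ones (zeros js))) (trans (+-identityʳ _) (length-replicate (zeros js)))) us≤m ⨾≤
  move-run (λ ()) _ (≤-trans (length-binary (zeros js)) zeros≤m) ⨾≤
  push≤
  where
  zeros≤m : zeros js ≤ m
  zeros≤m = ≤-trans (zeros≤ js) js≤m

  us≤m : length (ones (zeros js)) ≤ m
  us≤m = subst (_≤ m) (sym (length-replicate (zeros js))) zeros≤m

clear-run : ∀ {n m} {s : Fin n} (ρ : Store n) → length (lookup ρ s) ≤ m →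
            clear s ⊢ ρ ⇓≤[ loopCost m 1 ] ρ [ s ]≔ []
clear-run {m = m} {s} ρ ≤m =
  subst (λ ρ₁ → clear s ⊢ ρ₁ ⇓≤[ loopCost m 1 ] ρ [ s ]≔ []) ([]≔-lookup ρ s)
    (forEach-run′ {A = ⊤} (λ _ → ρ) (λ a _ → a) (λ _ _ _ → exactly skip) (lookup ρ s) refl ≤m)

numerals : List ℕ → Stack
numerals = concatMap (λ z → binary z ++ [ comma ])

tally : ℕ → List ℕ → List ℕ
tally zero    js = []
tally (suc n) js = zeros js ∷ tally n (preds js)

preds^ : ℕ → List ℕ → List ℕ
preds^ zero    js = js
preds^ (suc n) js = preds^ n (preds js)

length-preds^ : ∀ n js → length (unaries (preds^ n js)) ≤ length (unaries js)
length-preds^ zero    js = ≤-refl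
length-preds^ (suc n) js = ≤-trans (length-preds^ n (preds js)) (length-preds js)

tallyStep : List ℕ × Stack → Symbol → List ℕ × Stack
tallyStep (js , r) _ = preds js , comma ∷ binary (zeros js) ʳ++ r

tally-ones : ∀ n js r → foldl tallyStep (js , r) (ones n) ≡ (preds^ n js , numerals (tally n js) ʳ++ r)
tally-ones zero    js r = refl
tally-ones (suc n) js r =
  trans (tally-ones n (preds js) _)
        (cong (preds^ n (preds js) ,_) (sym (terminated-ʳ++ (binary (zeros js)) comma (numerals (tally n (preds js))) r)))

ʳ++-terminated : ∀ {A : Set} (xs : List A) x ys → (xs ++ [ x ]) ʳ++ ys ≡ x ∷ xs ʳ++ ys
ʳ++-terminated xs x ys = ++-ʳ++ xs

tallyAll : Program (9 + k)
tallyAll =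
  forEach N (λ _ → tallyVertex) ⨾
  push R semicolon ⨾
  clear I ⨾
  move R W

tallyAllCost : ℕ → ℕ → ℕ
tallyAllCost m m′ = loopCost m (tallyCost m) + (1 + (loopCost m 1 + loopCost m′ 1))

-- `R` starts with the graph in reverse and receives the weights on top, so the single final move
-- delivers both in the order of `encodeWeightedGraph`. Clearing `I` disposes of entries that `n`
-- passes do not reach.
tallyAll-run : ∀ n g js → n ≤ m → length (unaries js) ≤ m →
  length (g ++ numerals (tally n js) ++ [ semicolon ]) ≤ m′ →
  tallyAll ⊢ unaries js ∷ (g ʳ++ []) ∷ ones n ∷ s ∷ [] ∷ [] ∷ [] ∷ [] ∷ [] ∷ ρ ⇓≤[ tallyAllCost m m′ ]
             [] ∷ [] ∷ [] ∷ s ∷ [] ∷ [] ∷ [] ∷ [] ∷ (g ++ numerals (tally n js) ++ [ semicolon ]) ∷ ρ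
tallyAll-run {m} {s = s} {ρ = ρ} n g js n≤m js≤m g≤m′ =
  forEach-run (λ (js , r) → unaries js ∷ r ∷ [] ∷ s ∷ [] ∷ [] ∷ [] ∷ [] ∷ [] ∷ ρ) tallyStep
    (λ (js , _) _ → length (unaries js) ≤ m)
    (λ {(js , _)} → ≤-trans (length-preds js))
    (λ {(js , _)} → tallyVertex-run js)
    (ones n) js≤m (tally-ones n js (g ʳ++ [])) (subst (_≤ m) (sym (length-replicate n)) n≤m) ⨾≤
  push≤ ⨾≤
  clear-run _ (≤-trans (length-preds^ n js) js≤m) ⨾≤
  restore-run (λ ()) (g ++ numerals (tally n js) ++ [ semicolon ]) _
    (sym (trans (++-ʳ++ g) (ʳ++-terminated (numerals (tally n js)) semicolon (g ʳ++ [])))) refl g≤m′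

-- Parsing the input

-- The flag is set while the graph is being read.
readStep : Bool × Stack × ℕ × Stack → Symbol → Bool × Stack × ℕ × Stack
readStep (true  , r , n , d) semicolon = false , semicolon ∷ r , n , d
readStep (true  , r , n , d) comma     = true , comma ∷ r , suc n , d
readStep (true  , r , n , d) x         = true , x ∷ r , n , d
readStep (false , r , n , d) x         = false , r , n , x ∷ d

module _ {A : Set} (enc : A → Stack) (bits : ∀ x → All IsBit (enc x)) where

  private
    rows : List A → Stack
    rows = concatMap (λ x → enc x ++ [ comma ])

  read-bits : ∀ {xs r n d} → All IsBit xs → foldl readStep (true , r , n , d) xs ≡ (true , xs ʳ++ r , n , d)
  read-bits []       = refl
  read-bits (𝟎 ∷ bs) = read-bits bs
  read-bits (𝟏 ∷ bs) = read-bits bs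

  read-rows : ∀ xs r n d → foldl readStep (true , r , n , d) (rows xs) ≡ (true , rows xs ʳ++ r , length xs + n , d)
  read-rows []       r n d = refl
  read-rows (x ∷ xs) r n d = begin
    foldl readStep (true , r , n , d) ((enc x ++ [ comma ]) ++ rows xs)
      ≡⟨ foldl-terminated readStep _ (enc x) comma (rows xs) ⟩
    foldl readStep (readStep (foldl readStep (true , r , n , d) (enc x)) comma) (rows xs)
      ≡⟨ cong (λ a → foldl readStep (readStep a comma) (rows xs)) (read-bits (bits x)) ⟩
    foldl readStep (true , comma ∷ enc x ʳ++ r , suc n , d) (rows xs)
      ≡⟨ read-rows xs _ (suc n) d ⟩
    (true , rows xs ʳ++ comma ∷ enc x ʳ++ r , length xs + suc n , d)
      ≡⟨ cong₂ (λ r n → true , r , n , d) (sym (terminated-ʳ++ (enc x) comma (rows xs) r)) (+-suc (length xs) n) ⟩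
    (true , rows (x ∷ xs) ʳ++ r , suc (length xs + n) , d)
      ∎
    where open ≡-Reasoning

  read-rest : ∀ ps r n d → foldl readStep (false , r , n , d) ps ≡ (false , r , n , ps ʳ++ d)
  read-rest []       r n d = refl
  read-rest (p ∷ ps) r n d = read-rest ps r n (p ∷ d)

  -- Rows consist of bits only, so every comma before the first semicolon ends a row, and counting
  -- commas counts vertices.
  read-input : ∀ xs ps → foldl readStep (true , [] , 0 , []) (encodeList enc xs ++ ps) ≡
                         (false , encodeList enc xs ʳ++ [] , length xs , ps ʳ++ [])
  read-input xs ps = begin
    foldl readStep (true , [] , 0 , []) ((rows xs ++ [ semicolon ]) ++ ps)
      ≡⟨ foldl-terminated readStep _ (rows xs) semicolon ps ⟩
    foldl readStep (readStep (foldl readStep (true , [] , 0 , []) (rows xs)) semicolon) ps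
      ≡⟨ cong (λ a → foldl readStep (readStep a semicolon) ps) (read-rows xs [] 0 []) ⟩
    foldl readStep (false , semicolon ∷ rows xs ʳ++ [] , length xs + 0 , []) ps
      ≡⟨ read-rest ps _ _ [] ⟩
    (false , semicolon ∷ rows xs ʳ++ [] , length xs + 0 , ps ʳ++ [])
      ≡⟨ cong₂ (λ r n → false , r , n , ps ʳ++ [])
               (sym (ʳ++-terminated (rows xs) semicolon [])) (+-identityʳ (length xs)) ⟩
    (false , encodeList enc xs ʳ++ [] , length xs , ps ʳ++ [])
      ∎
    where open ≡-Reasoning

-- The test of `F` has already popped it; the semicolon alone does not push it back, and this ends
-- the graph phase.
readGraphSymbol : Symbol → Program (9 + k)
readGraphSymbol semicolon = push R semicolon
readGraphSymbol comma     = push F 𝟏 ⨾ push N 𝟏 ⨾ push R comma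
readGraphSymbol x         = push F 𝟏 ⨾ push R x

parse : Program (9 + k)
parse =
  push F 𝟏 ⨾
  forEach I (λ x → ifPop F (readGraphSymbol x) (push D x)) ⨾
  -- The top of `D` is the terminator of the pebble list. The rest is written out twice: tallying
  -- destroys the copy on `I`, and relocation reads the one on `S`.
  discard D ⨾
  forEach D (λ x → push I x ⨾ push S x)

parseCost : ℕ → ℕ
parseCost m = 1 + (loopCost m 4 + (2 + loopCost m 2))

parse-run : ∀ {A : Set} (enc : A → Stack) (bits : ∀ x → All IsBit (enc x)) xs js →
  length (encodeList enc xs ++ unaries js ++ [ semicolon ]) ≤ m →
  parse ⊢ (encodeList enc xs ++ unaries js ++ [ semicolon ]) ∷ [] ∷ [] ∷ [] ∷ [] ∷ [] ∷ [] ∷ [] ∷ ρ ⇓≤[ parseCost m ]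
          unaries js ∷ (encodeList enc xs ʳ++ []) ∷ ones (length xs) ∷ unaries js ∷ [] ∷ [] ∷ [] ∷ [] ∷ ρ
parse-run {m} {ρ = ρ} enc bits xs js ≤m =
  push≤ ⨾≤
  forEach-run′ scan readStep body _ input ≤m ⨾≤
  exactly {b = 2} (pop skip) ⨾≤
  forEach-run′ (λ w → w ∷ (encodeList enc xs ʳ++ []) ∷ ones (length xs) ∷ w ∷ [] ∷ [] ∷ [] ∷ [] ∷ ρ) (flip _∷_)
    (λ _ _ _ → exactly (push ⨾ push)) (unaries js ʳ++ [])
    (trans (ʳ++-ʳ++ (unaries js)) (++-identityʳ _)) reversed≤m
  where
  scan : Bool × Stack × ℕ × Stack → Store _
  scan (b , r , n , d) = [] ∷ r ∷ ones n ∷ [] ∷ [] ∷ [] ∷ d ∷ flag b ∷ ρ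

  body : ∀ a x xs → ifPop F (readGraphSymbol x) (push D x) ⊢ scan a [ I ]≔ xs ⇓≤[ 4 ] scan (readStep a x) [ I ]≔ xs
  body (true  , _) 𝟎         _ = exactly (pop (push ⨾ push))
  body (true  , _) 𝟏         _ = exactly (pop (push ⨾ push))
  body (true  , _) comma     _ = exactly (pop (push ⨾ push ⨾ push))
  body (true  , _) semicolon _ = exactly (pop push)
  body (false , _) _         _ = exactly (pop push)

  input : foldl readStep (true , [] , 0 , []) (encodeList enc xs ++ unaries js ++ [ semicolon ]) ≡
          (false , encodeList enc xs ʳ++ [] , length xs , semicolon ∷ unaries js ʳ++ [])
  input = trans (read-input enc bits xs (unaries js ++ [ semicolon ]))
                (cong (λ d → false , encodeList enc xs ʳ++ [] , length xs , d) (ʳ++-terminated (unaries js) semicolon []))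

  reversed≤m : length (unaries js ʳ++ []) ≤ m
  reversed≤m = begin
    length (unaries js ʳ++ [])                                  ≡⟨ trans (length-ʳ++ (unaries js)) (+-identityʳ _) ⟩
    length (unaries js)                                         ≤⟨ length-++-≤ˡ (unaries js) ⟩
    length (unaries js ++ [ semicolon ])                        ≤⟨ length-++-≤ʳ _ {encodeList enc xs} ⟩
    length (encodeList enc xs ++ unaries js ++ [ semicolon ])   ≤⟨ ≤m ⟩
    m                                                           ∎
    where open ≤-Reasoning

-- Relocating the pebbles

-- Equals n, which is not a vertex, when the subset is empty.
firstInside : ∀ {n} → Subset n → ℕ
firstInside []          = 0
firstInside (true ∷ K)  = 0
firstInside (false ∷ K) = suc (firstInside K)

-- This is the flag with which the search for the first member ends: still set when no member was
-- met.
isEmpty : ∀ {n} → Subset n → Bool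
isEmpty []          = true
isEmpty (true ∷ K)  = false
isEmpty (false ∷ K) = isEmpty K

locateStep : Bool × Stack × ℕ → Symbol → Bool × Stack × ℕ
locateStep (true , d , z) 𝟎 = true , 𝟎 ∷ d , suc z
locateStep (b    , d , z) 𝟏 = false , 𝟏 ∷ d , z
locateStep (b    , d , z) x = b , x ∷ d , z

locate-found : ∀ {n} (K : Subset n) d z → foldl locateStep (false , d , z) (encodeSubset K) ≡
                                          (false , encodeSubset K ʳ++ d , z)
locate-found []          d z = refl
locate-found (true ∷ K)  d z = locate-found K _ z
locate-found (false ∷ K) d z = locate-found K _ z

locate-subset : ∀ {n} (K : Subset n) d z → foldl locateStep (true , d , z) (encodeSubset K) ≡
                                           (isEmpty K , encodeSubset K ʳ++ d , firstInside K + z)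
locate-subset []          d z = refl
locate-subset (true ∷ K)  d z = locate-found K _ z
locate-subset (false ∷ K) d z =
  trans (locate-subset K _ (suc z)) (cong (λ y → isEmpty K , encodeSubset K ʳ++ 𝟎 ∷ d , y) (+-suc (firstInside K) z))

locateSymbol : Symbol → Program (9 + k)
locateSymbol 𝟎 = ifPop F (push F 𝟏 ⨾ push U 𝟏) skip
locateSymbol 𝟏 = discard F
locateSymbol _ = skip

locate : Program (9 + k)
locate = push F 𝟏 ⨾ forEach W (λ x → push D x ⨾ locateSymbol x) ⨾ discard F ⨾ move D W

locateCost : ℕ → ℕ
locateCost m = 1 + (loopCost m 4 + (2 + loopCost m 1))

locate-run : ∀ {n} (K : Subset n) → length (encodeSubset K) ≤ m →
  locate ⊢ [] ∷ [] ∷ [] ∷ s ∷ [] ∷ [] ∷ [] ∷ [] ∷ encodeSubset K ∷ ρ ⇓≤[ locateCost m ]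
           [] ∷ [] ∷ [] ∷ s ∷ ones (firstInside K) ∷ [] ∷ [] ∷ [] ∷ encodeSubset K ∷ ρ
locate-run {m} {s = s} {ρ = ρ} K K≤m =
  push≤ ⨾≤
  forEach-run′ scan locateStep body (encodeSubset K)
    (trans (locate-subset K [] 0) (cong (λ z → isEmpty K , encodeSubset K ʳ++ [] , z) (+-identityʳ (firstInside K))))
    K≤m ⨾≤
  unflag (isEmpty K) ⨾≤
  restore-run (λ ()) (encodeSubset K) _ refl refl K≤m
  where
  scan : Bool × Stack × ℕ → Store _
  scan (b , d , z) = [] ∷ [] ∷ [] ∷ s ∷ ones z ∷ [] ∷ d ∷ flag b ∷ [] ∷ ρ

  body : ∀ a x xs → push D x ⨾ locateSymbol x ⊢ scan a [ W ]≔ xs ⇓≤[ 4 ] scan (locateStep a x) [ W ]≔ xs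
  body (true  , _) 𝟎         _ = exactly (push ⨾ pop (push ⨾ push))
  body (false , _) 𝟎         _ = exactly (push ⨾ pop skip)
  body (true  , _) 𝟏         _ = exactly (push ⨾ pop skip)
  body (false , _) 𝟏         _ = exactly (push ⨾ pop skip)
  body (true  , _) comma     _ = exactly (push ⨾ skip)
  body (false , _) comma     _ = exactly (push ⨾ skip)
  body (true  , _) semicolon _ = exactly (push ⨾ skip)
  body (false , _) semicolon _ = exactly (push ⨾ skip)

  unflag : ∀ b →
    discard F ⊢ [] ∷ [] ∷ [] ∷ s ∷ ones (firstInside K) ∷ [] ∷ (encodeSubset K ʳ++ []) ∷ flag b ∷ [] ∷ ρ ⇓≤[ 2 ]
                [] ∷ [] ∷ [] ∷ s ∷ ones (firstInside K) ∷ [] ∷ (encodeSubset K ʳ++ []) ∷ [] ∷ [] ∷ ρ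
  unflag true  = exactly (pop skip)
  unflag false = exactly (pop skip)

-- In a state (d , w , r), w holds the bits of the clique from the vertex
-- reached so far in the current entry onwards and d the earlier bits, reversed.
relocateStep : ℕ → Stack × Stack × Stack → Symbol → Stack × Stack × Stack
relocateStep z (d , x ∷ w , r) 𝟏     = x ∷ d , w , r
relocateStep z (d , 𝟏 ∷ w , r) comma = [] , d ʳ++ 𝟏 ∷ w , comma ∷ ones (length d) ʳ++ r
relocateStep z (d , x ∷ w , r) comma = [] , d ʳ++ x ∷ w , comma ∷ ones z ʳ++ r
relocateStep z (d , []    , r) comma = d , [] , comma ∷ r
relocateStep z a               _     = a

endVertex : ∀ {n} → Subset n → Fin n → ℕ
endVertex K v = if lookup K v then toℕ v else firstInside K

-- Each 𝟏 of the name moves one bit across. At the comma the top of the remaining bits answers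
-- membership, and from an empty start the number of bits moved is the vertex itself, ready to be
-- written out. The stack `d` is general for the induction.
relocate-vertex : ∀ {n} (K : Subset n) v d r →
  relocateStep z (foldl (relocateStep z) (d , encodeSubset K , r) (encodeVertex v)) comma ≡
  ([] , d ʳ++ encodeSubset K , comma ∷ ones (if lookup K v then toℕ v + length d else z) ʳ++ r)
relocate-vertex (true  ∷ K) zero    d r = refl
relocate-vertex (false ∷ K) zero    d r = refl
relocate-vertex {z} (b ∷ K) (suc v) d r =
  trans (relocate-vertex K v (encodeBit b ∷ d) r)
        (cong (λ y → [] , d ʳ++ encodeSubset (b ∷ K) , comma ∷ ones (if lookup K v then y else z) ʳ++ r)
              (+-suc (toℕ v) (length d)))

relocate-unaries : ∀ {n} (K : Subset n) vs r →
  foldl (relocateStep (firstInside K)) ([] , encodeSubset K , r) (unaries (map toℕ vs)) ≡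
  ([] , encodeSubset K , unaries (map (endVertex K) vs) ʳ++ r)
relocate-unaries K []       r = refl
relocate-unaries K (v ∷ vs) r = begin
  foldl step ([] , encodeSubset K , r) ((encodeVertex v ++ [ comma ]) ++ unaries (map toℕ vs))
    ≡⟨ foldl-terminated step _ (encodeVertex v) comma (unaries (map toℕ vs)) ⟩
  foldl step (step (foldl step ([] , encodeSubset K , r) (encodeVertex v)) comma) (unaries (map toℕ vs))
    ≡⟨ cong (λ a → foldl step a (unaries (map toℕ vs))) (trans (relocate-vertex K v [] r) end) ⟩
  foldl step ([] , encodeSubset K , comma ∷ ones (endVertex K v) ʳ++ r) (unaries (map toℕ vs))
    ≡⟨ relocate-unaries K vs _ ⟩
  ([] , encodeSubset K , unaries (map (endVertex K) vs) ʳ++ comma ∷ ones (endVertex K v) ʳ++ r)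
    ≡⟨ cong (λ r → [] , encodeSubset K , r)
            (terminated-ʳ++ (ones (endVertex K v)) comma (unaries (map (endVertex K) vs)) r) ⟨
  ([] , encodeSubset K , unaries (map (endVertex K) (v ∷ vs)) ʳ++ r)
    ∎
  where
  open ≡-Reasoning
  step : Stack × Stack × Stack → Symbol → Stack × Stack × Stack
  step = relocateStep (firstInside K)

  end : ([] , encodeSubset K , comma ∷ ones (if lookup K v then toℕ v + 0 else firstInside K) ʳ++ r) ≡
        ([] , encodeSubset K , comma ∷ ones (endVertex K v) ʳ++ r)
  end = cong (λ y → [] , encodeSubset K , comma ∷ ones (if lookup K v then y else firstInside K) ʳ++ r)
             (+-identityʳ (toℕ v))

-- For a member, every bit that returns from `D` to `W` emits a 𝟏, which spells the start vertex
-- again. Otherwise `U` is emitted; since reading destroys it, a copy on `D` is moved back. Either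
-- way `W` holds the whole clique for the next entry.
emitEndVertex : Symbol → Program (9 + k)
emitEndVertex 𝟏 = push W 𝟏 ⨾ forEach D (λ x → push W x ⨾ push R 𝟏)
emitEndVertex x = push W x ⨾ move D W ⨾ forEach U (λ y → push R y ⨾ push D y) ⨾ move D U

relocateSymbol : Symbol → Program (9 + k)
relocateSymbol 𝟏     = pop W (maybe (push D) skip)
relocateSymbol comma = pop W (maybe emitEndVertex skip) ⨾ push R comma
relocateSymbol _     = skip

emitCost : ℕ → ℕ
emitCost m = 1 + (loopCost m 1 + (loopCost m 2 + loopCost m 1))

relocateCost : ℕ → ℕ
relocateCost m = suc (emitCost m) + 1

module _ {ρ : Store k} (z≤m : z ≤ m) where

  private
    place : Stack → Stack × Stack × Stack → Store (9 + k)
    place s (d , w , r) = [] ∷ r ∷ [] ∷ s ∷ ones z ∷ [] ∷ d ∷ [] ∷ w ∷ ρ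

    ones≤m : length (ones z) ≤ m
    ones≤m = subst (_≤ m) (sym (length-replicate z)) z≤m

    emitStep : Stack × Stack → Symbol → Stack × Stack
    emitStep (w , r) x = x ∷ w , 𝟏 ∷ r

    emit-stack : ∀ d {w r} → foldl emitStep (w , r) d ≡ (d ʳ++ w , ones (length d) ʳ++ r)
    emit-stack []      = refl
    emit-stack (_ ∷ d) = emit-stack d

    copyStep : Stack × Stack → Symbol → Stack × Stack
    copyStep (r , d) x = x ∷ r , x ∷ d

    copy-stack : ∀ xs {r d} → foldl copyStep (r , d) xs ≡ (xs ʳ++ r , xs ʳ++ d)
    copy-stack []       = refl
    copy-stack (_ ∷ xs) = copy-stack xs

    emit-inside : ∀ {s} d {w r} → length d ≤ m →
      emitEndVertex 𝟏 ⊢ place s (d , w , r) ⇓≤[ emitCost m ] place s ([] , d ʳ++ 𝟏 ∷ w , ones (length d) ʳ++ r)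
    emit-inside {s} d d≤m = weaken (s≤s (≤-trans (m≤m+n _ (loopCost m 1)) (m≤n+m _ (loopCost m 1))))
      (push≤ ⨾≤
       forEach-run′ (λ (w , r) → place s ([] , w , r)) emitStep (λ _ _ _ → exactly (push ⨾ push)) d (emit-stack d) d≤m)

    emit-outside : ∀ {s} d {w r x} → length d ≤ m →
      push W x ⨾ move D W ⨾ forEach U (λ y → push R y ⨾ push D y) ⨾ move D U ⊢ place s (d , w , r) ⇓≤[ emitCost m ]
      place s ([] , d ʳ++ x ∷ w , ones z ʳ++ r)
    emit-outside {s} d {w} {r} {x} d≤m =
      push≤ ⨾≤
      move-run (λ ()) _ d≤m ⨾≤
      forEach-run′ (λ (r , c) → [] ∷ r ∷ [] ∷ s ∷ [] ∷ [] ∷ c ∷ [] ∷ (d ʳ++ x ∷ w) ∷ ρ) copyStep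
        (λ _ _ _ → exactly (push ⨾ push)) (ones z) (copy-stack (ones z)) ones≤m ⨾≤
      restore-run (λ ()) (ones z) _ refl refl ones≤m

    -- Bits only travel between the two stacks, so the sum never grows; it bounds the cost of moving
    -- them back.
    Within : Stack × Stack × Stack → List Symbol → Set
    Within (d , w , _) _ = length d + length w ≤ m

    settled : ∀ (d : Stack) x w → length d + length (x ∷ w) ≤ m → length (d ʳ++ x ∷ w) ≤ m
    settled d x w = subst (_≤ m) (sym (length-ʳ++ d))

    within-step : ∀ {a x xs} → Within a (x ∷ xs) → Within (relocateStep z a x) xs
    within-step {a = _ , []            , _} {𝟎}         p = p
    within-step {a = _ , _ ∷ _         , _} {𝟎}         p = p
    within-step {a = _ , []            , _} {𝟏}         p = p
    within-step {a = d , _ ∷ w         , _} {𝟏}         p = subst (_≤ m) (+-suc (length d) (length w)) p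
    within-step {a = _ , []            , _} {comma}     p = p
    within-step {a = d , 𝟎 ∷ w         , _} {comma}     p = settled d 𝟎 w p
    within-step {a = d , 𝟏 ∷ w         , _} {comma}     p = settled d 𝟏 w p
    within-step {a = d , comma ∷ w     , _} {comma}     p = settled d comma w p
    within-step {a = d , semicolon ∷ w , _} {comma}     p = settled d semicolon w p
    within-step {a = _ , []            , _} {semicolon} p = p
    within-step {a = _ , _ ∷ _         , _} {semicolon} p = p

    fast : ∀ {n} {c : Program n} {ρ₁ ρ₂} → c ⊢ ρ₁ ⇓≤[ 2 ] ρ₂ → c ⊢ ρ₁ ⇓≤[ relocateCost m ] ρ₂
    fast = weaken (s≤s (s≤s z≤n))

    body : ∀ {a x xs} → Within a (x ∷ xs) →
           relocateSymbol x ⊢ place xs a ⇓≤[ relocateCost m ] place xs (relocateStep z a x)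
    body {a = _ , []            , _} {𝟎}         p = fast (exactly skip)
    body {a = _ , _ ∷ _         , _} {𝟎}         p = fast (exactly skip)
    body {a = _ , []            , _} {𝟏}         p = fast (exactly (pop skip))
    body {a = _ , _ ∷ _         , _} {𝟏}         p = fast (exactly (pop push))
    body {a = _ , []            , _} {comma}     p = weaken (s≤s (s≤s (s≤s z≤n))) (exactly {b = 2} (pop skip) ⨾≤ push≤)
    body {a = d , 𝟎 ∷ w         , _} {comma}     p = pop≤ (emit-outside d (m+n≤o⇒m≤o (length d) p)) ⨾≤ push≤
    body {a = d , 𝟏 ∷ w         , _} {comma}     p = pop≤ (emit-inside d (m+n≤o⇒m≤o (length d) p)) ⨾≤ push≤
    body {a = d , comma ∷ w     , _} {comma}     p = pop≤ (emit-outside d (m+n≤o⇒m≤o (length d) p)) ⨾≤ push≤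
    body {a = d , semicolon ∷ w , _} {comma}     p = pop≤ (emit-outside d (m+n≤o⇒m≤o (length d) p)) ⨾≤ push≤
    body {a = _ , []            , _} {semicolon} p = fast (exactly skip)
    body {a = _ , _ ∷ _         , _} {semicolon} p = fast (exactly skip)

  relocatePebbles-run : ∀ {w r a′} xs → length w ≤ m → length xs ≤ m →
    foldl (relocateStep z) ([] , w , r) xs ≡ a′ →
    forEach S relocateSymbol ⊢ place xs ([] , w , r) ⇓≤[ loopCost m (relocateCost m) ] place [] a′
  relocatePebbles-run xs w≤m xs≤m eq = forEach-run (place []) (relocateStep z) Within
    (λ {a} {x} {xs} → within-step {a} {x} {xs}) (λ {a} {x} {xs} → body {a} {x} {xs}) xs w≤m eq xs≤m

relocate : Program (9 + k)
relocate = locate ⨾ forEach S relocateSymbol ⨾ push R semicolon ⨾ move R I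

relocationCost : ℕ → ℕ → ℕ
relocationCost m m′ = locateCost m + (loopCost m (relocateCost m) + (1 + loopCost m′ 1))

relocate-run : ∀ {n} (K : Subset n) vs →
  length (encodeSubset K) ≤ m → firstInside K ≤ m → length (unaries (map toℕ vs)) ≤ m →
  length (unaries (map (endVertex K) vs) ++ [ semicolon ]) ≤ m′ →
  relocate ⊢ [] ∷ [] ∷ [] ∷ unaries (map toℕ vs) ∷ [] ∷ [] ∷ [] ∷ [] ∷ encodeSubset K ∷ ρ ⇓≤[ relocationCost m m′ ]
             (unaries (map (endVertex K) vs) ++ [ semicolon ]) ∷ [] ∷ [] ∷ [] ∷
             ones (firstInside K) ∷ [] ∷ [] ∷ [] ∷ encodeSubset K ∷ ρ
relocate-run K vs K≤m first≤m vs≤m out≤m′ =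
  locate-run K K≤m ⨾≤
  relocatePebbles-run first≤m (unaries (map toℕ vs)) K≤m vs≤m (relocate-unaries K vs []) ⨾≤
  push≤ ⨾≤
  restore-run (λ ()) (unaries (map (endVertex K) vs) ++ [ semicolon ]) _
    (sym (ʳ++-terminated (unaries (map (endVertex K) vs)) semicolon [])) refl out≤m′

-- Optimality

occurrences : ℕ → List ℕ → ℕ
occurrences v js = zeros (preds^ v js)

tally-occurrences : ∀ n js → tally n js ≡ map (λ v → occurrences (toℕ v) js) (allFin n)
tally-occurrences n js = trans (tabulated n js) (sym (map-tabulate (λ v → v) (λ v → occurrences (toℕ v) js)))
  where
  tabulated : ∀ n js → tally n js ≡ tabulate (λ (v : Fin n) → occurrences (toℕ v) js)
  tabulated zero    js = refl
  tabulated (suc n) js = cong (zeros js ∷_) (tabulated n (preds js))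

module _ {A : Set} {P Q : Pred A 0ℓ} (P? : Decidable P) (Q? : Decidable Q) where

  length-filter-mono : (∀ {x} → P x → Q x) → ∀ xs → length (filter P? xs) ≤ length (filter Q? xs)
  length-filter-mono P⇒Q []       = z≤n
  length-filter-mono P⇒Q (x ∷ xs) with P? x | Q? x
  ... | yes p | yes q = s≤s (length-filter-mono P⇒Q xs)
  ... | yes p | no ¬q = contradiction (P⇒Q p) ¬q
  ... | no ¬p | yes q = m≤n⇒m≤1+n (length-filter-mono P⇒Q xs)
  ... | no ¬p | no ¬q = length-filter-mono P⇒Q xs

module _ {A : Set} {P : Pred A 0ℓ} (P? : Decidable P) where

  length-filter-¬ : ∀ xs → length (filter P? xs) + length (filter (λ x → ¬? (P? x)) xs) ≡ length xs
  length-filter-¬ []       = refl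
  length-filter-¬ (x ∷ xs) with P? x
  ... | yes p = cong suc (length-filter-¬ xs)
  ... | no ¬p = trans (+-suc _ _) (cong suc (length-filter-¬ xs))

  length-filter-map : ∀ {B : Set} (f : B → A) xs → length (filter P? (map f xs)) ≡ length (filter (λ x → P? (f x)) xs)
  length-filter-map f []       = refl
  length-filter-map f (x ∷ xs) with does (P? (f x))
  ... | true  = cong suc (length-filter-map f xs)
  ... | false = length-filter-map f xs

-- The typed counterpart of `preds`: with vertex zero gone the others fit into `Fin n`, which
-- permits induction along the subset.
lower : ∀ {n} → List (Fin (suc n)) → List (Fin n)
lower []           = []
lower (zero ∷ vs)  = lower vs
lower (suc v ∷ vs) = v ∷ lower vs

preds-lower : ∀ {n} (vs : List (Fin (suc n))) → preds (map toℕ vs) ≡ map toℕ (lower vs)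
preds-lower []           = refl
preds-lower (zero ∷ vs)  = preds-lower vs
preds-lower (suc v ∷ vs) = cong (toℕ v ∷_) (preds-lower vs)

weigh : ∀ {n} → Subset n → (Fin n → ℕ) → ℕ
weigh K w = sum (map w (filter (_∈? K) (allFin _)))

weigh-∷ : ∀ {n} b (K : Subset n) w → weigh (b ∷ K) w ≡ (if b then w zero else 0) + weigh K (λ v → w (suc v))
weigh-∷ b K w =
  trans (head-first b)
        (cong ((if b then w zero else 0) +_)
              (trans (cong tailSum (sym (map-tabulate (λ v → v) suc))) (tail-sum (allFin _))))
  where
  tailSum : List (Fin _) → ℕ
  tailSum vs = sum (map w (filter (_∈? (b ∷ K)) vs))

  head-first : ∀ b → sum (map w (filter (_∈? (b ∷ K)) (zero ∷ tabulate suc))) ≡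
               (if b then w zero else 0) + sum (map w (filter (_∈? (b ∷ K)) (tabulate suc)))
  head-first true  = refl
  head-first false = refl

  tail-sum : ∀ vs → tailSum (map suc vs) ≡ sum (map (λ v → w (suc v)) (filter (_∈? K) vs))
  tail-sum []       = refl
  tail-sum (v ∷ vs) with does (v ∈? K)
  ... | true  = cong (w (suc v) +_) (tail-sum vs)
  ... | false = tail-sum vs

filter-∷ : ∀ {n} b (K : Subset n) vs →
           (if b then zeros (map toℕ vs) else 0) + length (filter (_∈? K) (lower vs)) ≡ length (filter (_∈? (b ∷ K)) vs)
filter-∷ true  K []           = refl
filter-∷ false K []           = refl
filter-∷ true  K (zero ∷ vs)  = cong suc (filter-∷ true K vs)
filter-∷ false K (zero ∷ vs)  = filter-∷ false K vs
filter-∷ b     K (suc v ∷ vs) with does (v ∈? K)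
filter-∷ true  K (suc v ∷ vs) | true  = trans (+-suc (zeros (map toℕ vs)) _) (cong suc (filter-∷ true K vs))
filter-∷ false K (suc v ∷ vs) | true  = cong suc (filter-∷ false K vs)
filter-∷ true  K (suc v ∷ vs) | false = filter-∷ true K vs
filter-∷ false K (suc v ∷ vs) | false = filter-∷ false K vs

-- A double count: list entries lying in `K`, grouped by vertex. Induction on `K` splits off vertex
-- zero, whose weight is the number of zeros; the other vertices see the list after one pass.
weigh-occurrences : ∀ {n} (K : Subset n) vs →
                    weigh K (λ v → occurrences (toℕ v) (map toℕ vs)) ≡ length (filter (_∈? K) vs)
weigh-occurrences []      []       = refl
weigh-occurrences (b ∷ K) vs       = begin
  weigh (b ∷ K) (λ v → occurrences (toℕ v) (map toℕ vs))
    ≡⟨ weigh-∷ b K _ ⟩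
  (if b then zeros (map toℕ vs) else 0) + weigh K (λ v → occurrences (toℕ v) (preds (map toℕ vs)))
    ≡⟨ cong (λ js → (if b then zeros (map toℕ vs) else 0) + weigh K (λ v → occurrences (toℕ v) js)) (preds-lower vs) ⟩
  (if b then zeros (map toℕ vs) else 0) + weigh K (λ v → occurrences (toℕ v) (map toℕ (lower vs)))
    ≡⟨ cong ((if b then zeros (map toℕ vs) else 0) +_) (weigh-occurrences K (lower vs)) ⟩
  (if b then zeros (map toℕ vs) else 0) + length (filter (_∈? K) (lower vs))
    ≡⟨ filter-∷ b K vs ⟩
  length (filter (_∈? (b ∷ K)) vs)
    ∎
  where open ≡-Reasoning

firstInside≤ : ∀ {n} (K : Subset n) → firstInside K ≤ n
firstInside≤ []          = z≤n
firstInside≤ (true ∷ K)  = z≤n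
firstInside≤ (false ∷ K) = s≤s (firstInside≤ K)

firstInside-∈ : ∀ {n} (K : Subset n) {v} → v ∈ K → ∃[ u ] u ∈ K × toℕ u ≡ firstInside K
firstInside-∈ (true ∷ K)  _           = zero , here , refl
firstInside-∈ (false ∷ K) (there v∈K) with firstInside-∈ K v∈K
... | u , u∈K , eq = suc u , there u∈K , cong suc eq

-- The member `w` makes `K` nonempty, so that the default `firstInside K` names a vertex of `K`. The
-- last component says that pebbles starting in `K` stay.
endVertex-∈ : ∀ {n} (K : Subset n) {w} → w ∈ K → ∀ v → ∃[ u ] u ∈ K × toℕ u ≡ endVertex K v × (v ∈ K → u ≡ v)
endVertex-∈ K w∈K v with lookup K v in eq | firstInside-∈ K w∈K
... | true  | _             = v , lookup⇒[]= v K eq , refl , λ _ → refl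
... | false | u , u∈K , u≡ = u , u∈K , u≡ , λ v∈K → contradiction (trans (sym eq) ([]=⇒lookup v∈K)) (λ ())

module PebbleWeights (I : PebbleInstance) where

  open PebbleInstance I
  open Graph graph using (order; Vertex; IsClique)

  starts : List Vertex
  starts = map σ (allFin pebbles)

  weighted : WeightedGraph
  weighted = record { graph = graph ; weight = λ v → occurrences (toℕ v) (map toℕ starts) }

  open WeightedGraph weighted using (totalWeight; IsMaximumWeightClique)

  startsIn : Subset order → ℕ
  startsIn K = length (filter (λ p → σ p ∈? K) (allFin pebbles))

  totalWeight≡ : ∀ K → totalWeight K ≡ startsIn K
  totalWeight≡ K = trans (weigh-occurrences K starts) (length-filter-map (_∈? K) σ (allFin pebbles))

  image : Placement → Subset order
  image μ = Vec.tabulate (λ v → does (any? (λ p → μ p ≟ v)))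

  ∈-image : ∀ μ p → μ p ∈ image μ
  ∈-image μ p = lookup⇒[]= (μ p) (image μ)
    (trans (lookup∘tabulate _ (μ p)) (dec-true (any? (λ q → μ q ≟ μ p)) (p , refl)))

  image-∈ : ∀ μ {v} → v ∈ image μ → Image μ v
  image-∈ μ {v} v∈ with any? (λ p → μ p ≟ v) in eq
  ... | yes p = p
  ... | no ¬p = contradiction (trans (sym (trans (lookup∘tabulate _ v) (cong does eq))) ([]=⇒lookup v∈)) (λ ())

  module _ {K : Subset order} (max : IsMaximumWeightClique K) where

    startsIn-max : ∀ K′ → IsClique (_∈ K′) → startsIn K′ ≤ startsIn K
    startsIn-max K′ clique = subst₂ _≤_ (totalWeight≡ K′) (totalWeight≡ K) (proj₂ max K′ clique)

    max-nonempty : Fin pebbles → Nonempty K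
    max-nonempty p with nonempty? K
    ... | yes K≢∅ = K≢∅
    ... | no  K≡∅ = contradiction
      (≤-trans (startsIn-max ⁅ σ p ⁆ singleton)
               (≤-reflexive (cong length (filter-none (λ q → σ q ∈? K) {allFin pebbles} outside))))
      (<⇒≱ (filter-some (λ q → σ q ∈? ⁅ σ p ⁆) (lose (∈-allFin p) (x∈⁅x⁆ (σ p)))))
      where
      singleton : IsClique (_∈ ⁅ σ p ⁆)
      singleton u∈ v∈ u≢v = contradiction (trans (x∈⁅y⁆⇒x≡y (σ p) u∈) (sym (x∈⁅y⁆⇒x≡y (σ p) v∈))) u≢v

      outside : All (λ q → ¬ σ q ∈ K) (allFin pebbles)
      outside = universal (λ q σq∈K → K≡∅ (σ q , σq∈K)) (allFin pebbles)

    optimal : ∀ μ → (∀ p → μ p ∈ K) → (∀ p → σ p ∈ K → μ p ≡ σ p) → IsOptimal μ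
    optimal μ μ∈K stays = feasible , λ μ′ feasible′ → begin
      Num μ
        ≤⟨ length-filter-mono (λ p → ¬? (σ p ≟ μ p)) (λ p → ¬? (σ p ∈? K))
             (λ σ≢μ σ∈K → σ≢μ (sym (stays _ σ∈K))) (allFin pebbles) ⟩
      startsOutside K
        ≤⟨ +-cancelˡ-≤ (startsIn K) _ _ (balance (image μ′) (image-clique μ′ feasible′)) ⟩
      startsOutside (image μ′)
        ≤⟨ length-filter-mono (λ p → ¬? (σ p ∈? image μ′)) (λ p → ¬? (σ p ≟ μ′ p))
             (λ {p} σ∉ σ≡μ′ → σ∉ (subst (_∈ image μ′) (sym σ≡μ′) (∈-image μ′ p))) (allFin pebbles) ⟩
      Num μ′
        ∎
      where
      open ≤-Reasoning

      startsOutside : Subset order → ℕ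
      startsOutside K = length (filter (λ p → ¬? (σ p ∈? K)) (allFin pebbles))

      feasible : Feasible μ
      feasible (p , refl) (q , refl) = proj₁ max (μ∈K p) (μ∈K q)

      image-clique : ∀ μ′ → Feasible μ′ → IsClique (_∈ image μ′)
      image-clique μ′ feasible′ u∈ v∈ = feasible′ (image-∈ μ′ u∈) (image-∈ μ′ v∈)

      -- Both cliques split the same set of pebbles, so more starts inside means fewer outside.
      -- Adding `startsIn K` on both sides avoids subtraction; the caller cancels it.
      balance : ∀ K′ → IsClique (_∈ K′) → startsIn K + startsOutside K ≤ startsIn K + startsOutside K′
      balance K′ clique = begin
        startsIn K + startsOutside K      ≡⟨ length-filter-¬ (λ p → σ p ∈? K) (allFin pebbles) ⟩
        length (allFin pebbles)           ≡⟨ length-filter-¬ (λ p → σ p ∈? K′) (allFin pebbles) ⟨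
        startsIn K′ + startsOutside K′    ≤⟨ +-monoˡ-≤ (startsOutside K′) (startsIn-max K′ clique) ⟩
        startsIn K + startsOutside K′     ∎

    private
      target : ∀ p → ∃[ u ] u ∈ K × toℕ u ≡ endVertex K (σ p) × (σ p ∈ K → u ≡ σ p)
      target p = endVertex-∈ K (proj₂ (max-nonempty p)) (σ p)

    placement : Placement
    placement p = proj₁ (target p)

    toℕ-placement : ∀ p → toℕ (placement p) ≡ endVertex K (σ p)
    toℕ-placement p = proj₁ (proj₂ (proj₂ (target p)))

    placement-optimal : IsOptimal placement
    placement-optimal = optimal placement (λ p → proj₁ (proj₂ (target p))) (λ p → proj₂ (proj₂ (proj₂ (target p))))

-- The reduction

bits-All : (f : A → Bool) → ∀ xs → All IsBit (map (λ x → encodeBit (f x)) xs)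
bits-All f []       = []
bits-All f (x ∷ xs) with f x
... | true  = 𝟏 ∷ bits-All f xs
... | false = 𝟎 ∷ bits-All f xs

length-encodeSubset : ∀ {n} (K : Subset n) → length (encodeSubset K) ≡ n
length-encodeSubset []      = refl
length-encodeSubset (_ ∷ K) = cong suc (length-encodeSubset K)

module _ (enc : A → Stack) where

  private
    rows : List A → Stack
    rows = concatMap (λ x → enc x ++ [ comma ])

  -- Every entry contributes at least its comma. This bounds the numbers of vertices and of pebbles
  -- by the input length.
  length≤encodeList : ∀ xs → length xs ≤ length (encodeList enc xs)
  length≤encodeList []       = z≤n
  length≤encodeList (x ∷ xs) = begin
    suc (length xs)
      ≤⟨ s≤s (length≤encodeList xs) ⟩
    suc (length (encodeList enc xs))
      ≤⟨ s≤s (length-++-≤ʳ (encodeList enc xs) {enc x}) ⟩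
    suc (length (enc x ++ encodeList enc xs))
      ≡⟨ length-++-sucʳ (enc x) comma (encodeList enc xs) ⟨
    length (enc x ++ comma ∷ encodeList enc xs)
      ≡⟨ cong length (++-assoc (enc x) [ comma ] (encodeList enc xs)) ⟨
    length ((enc x ++ [ comma ]) ++ encodeList enc xs)
      ≡⟨ cong length (++-assoc (enc x ++ [ comma ]) (rows xs) [ semicolon ]) ⟨
    length (encodeList enc (x ∷ xs))
      ∎
    where open ≤-Reasoning

  length-encodeList≤ : ∀ {b} → (∀ x → length (enc x) ≤ b) → ∀ xs → length (encodeList enc xs) ≤ length xs * suc b + 1
  length-encodeList≤ {b} enc≤b xs = begin
    length (rows xs ++ [ semicolon ])       ≡⟨ length-++ (rows xs) ⟩
    length (rows xs) + 1                    ≤⟨ +-monoˡ-≤ 1 (rows≤ xs) ⟩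
    length xs * suc b + 1                   ∎
    where
    open ≤-Reasoning

    rows≤ : ∀ xs → length (rows xs) ≤ length xs * suc b
    rows≤ []       = z≤n
    rows≤ (x ∷ xs) = begin
      length ((enc x ++ [ comma ]) ++ rows xs)          ≡⟨ length-++ (enc x ++ [ comma ]) ⟩
      length (enc x ++ [ comma ]) + length (rows xs)    ≡⟨ cong (_+ length (rows xs)) (trans (length-++ (enc x)) (+-comm _ 1)) ⟩
      suc (length (enc x)) + length (rows xs)           ≤⟨ +-mono-≤ (s≤s (enc≤b x)) (rows≤ xs) ⟩
      suc b + length xs * suc b                         ∎

unaries-map : ∀ (f : A → ℕ) xs → unaries (map f xs) ++ [ semicolon ] ≡ encodeList (λ x → ones (f x)) xs
unaries-map f xs = cong (_++ [ semicolon ]) (concatMap-map _ f xs)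

occurrences≤ : ∀ v js → occurrences v js ≤ length (unaries js)
occurrences≤ v js = ≤-trans (zeros≤ (preds^ v js)) (length-preds^ v js)

reduction : Program (suc k) → Program (9 + k)
reduction c = parse ⨾ tallyAll ⨾ liftBy 8 c ⨾ relocate

-- The graph takes at most `m` symbols; a list has at most `m` entries of at most `m` symbols and a
-- comma each, and one semicolon. It covers both the solver's input and the final output.
listBound : ℕ → ℕ
listBound m = m + (m * suc m + 1)

reductionCost : ℕ → ℕ → ℕ → ℕ
reductionCost a d m =
  parseCost m + (tallyAllCost m (listBound m) + ((a * listBound m ^ d + a) + relocationCost m (listBound m)))

-- The local bounds repeat the cost functions term by term, so that the indices of `Polynomial`
-- agree by unfolding.
reductionCost-polynomial : ∀ a d → Polynomial (reductionCost a d)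
reductionCost-polynomial a d =
  parseₚ +ₚ (tallyAllₚ +ₚ ((♯ a *ₚ (boundₚ ^ₚ d) +ₚ ♯ a) +ₚ relocationₚ))
  where
  ♯ : ∀ c → Polynomial (λ _ → c)
  ♯ = const-polynomial

  loop : ∀ {f g} → Polynomial f → Polynomial g → Polynomial (λ x → loopCost (f x) (g x))
  loop = loopCost-polynomial

  idₚ : Polynomial (λ x → x)
  idₚ = id-polynomial

  boundₚ : Polynomial listBound
  boundₚ = idₚ +ₚ (idₚ *ₚ (♯ 1 +ₚ idₚ) +ₚ ♯ 1)

  parseₚ : Polynomial parseCost
  parseₚ = ♯ 1 +ₚ (loop idₚ (♯ 4) +ₚ (♯ 2 +ₚ loop idₚ (♯ 2)))

  incrementₚ : Polynomial incrementCost
  incrementₚ = ♯ 1 +ₚ (loop idₚ (♯ 3) +ₚ (♯ 2 +ₚ loop (♯ 1 +ₚ idₚ) (♯ 1)))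

  decrementₚ : Polynomial decrementCost
  decrementₚ = ♯ 1 +ₚ (loop idₚ (♯ 3) +ₚ (♯ 2 +ₚ loop idₚ (♯ 1)))

  tallyₚ : Polynomial tallyCost
  tallyₚ = decrementₚ +ₚ (loop idₚ incrementₚ +ₚ (loop idₚ (♯ 1) +ₚ ♯ 1))

  tallyAllₚ : Polynomial (λ m → tallyAllCost m (listBound m))
  tallyAllₚ = loop idₚ tallyₚ +ₚ (♯ 1 +ₚ (loop idₚ (♯ 1) +ₚ loop boundₚ (♯ 1)))

  locateₚ : Polynomial locateCost
  locateₚ = ♯ 1 +ₚ (loop idₚ (♯ 4) +ₚ (♯ 2 +ₚ loop idₚ (♯ 1)))

  relocateₚ : Polynomial relocateCost
  relocateₚ = ♯ 1 +ₚ (♯ 1 +ₚ (loop idₚ (♯ 1) +ₚ (loop idₚ (♯ 2) +ₚ loop idₚ (♯ 1)))) +ₚ ♯ 1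

  relocationₚ : Polynomial (λ m → relocationCost m (listBound m))
  relocationₚ = locateₚ +ₚ (loop idₚ relocateₚ +ₚ (♯ 1 +ₚ loop boundₚ (♯ 1)))

module _ (I : PebbleInstance) where

  open PebbleInstance I
  open PebbleWeights I
  open Graph graph using (order; adjacent)

  private
    L : ℕ
    L = length (encodePebbleInstance I)

    js : List ℕ
    js = map toℕ starts

    js≡ : unaries js ++ [ semicolon ] ≡ encodeList (λ p → encodeVertex (σ p)) (allFin pebbles)
    js≡ = trans (unaries-map toℕ starts) (cong (_++ [ semicolon ]) (concatMap-map _ σ (allFin pebbles)))

    input≡ : encodeGraph graph ++ unaries js ++ [ semicolon ] ≡ encodePebbleInstance I
    input≡ = cong (encodeGraph graph ++_) js≡

    graph≤L : length (encodeGraph graph) ≤ L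
    graph≤L = length-++-≤ˡ (encodeGraph graph)

    length-allFin≤ : ∀ {n} (enc : Fin n → Stack) → n ≤ length (encodeList enc (allFin n))
    length-allFin≤ {n} enc =
      subst (_≤ length (encodeList enc (allFin n))) (length-tabulate (λ v → v)) (length≤encodeList enc (allFin n))

    order≤L : order ≤ L
    order≤L = ≤-trans (length-allFin≤ _) graph≤L

    pebbles≤L : pebbles ≤ L
    pebbles≤L = ≤-trans (length-allFin≤ (λ p → encodeVertex (σ p))) (length-++-≤ʳ _ {encodeGraph graph})

    js≤L : length (unaries js) ≤ L
    js≤L = begin
      length (unaries js)                                           ≤⟨ length-++-≤ˡ (unaries js) ⟩
      length (unaries js ++ [ semicolon ])                          ≤⟨ length-++-≤ʳ _ {encodeGraph graph} ⟩
      length (encodeGraph graph ++ unaries js ++ [ semicolon ])     ≡⟨ cong length input≡ ⟩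
      L                                                             ∎
      where open ≤-Reasoning

    list≤ : ∀ {n} (enc : Fin n → Stack) → n ≤ L → (∀ x → length (enc x) ≤ L) →
            length (encodeList enc (allFin n)) ≤ L * suc L + 1
    list≤ {n} enc n≤L enc≤L = begin
      length (encodeList enc (allFin n))   ≤⟨ length-encodeList≤ enc enc≤L (allFin n) ⟩
      length (allFin n) * suc L + 1        ≡⟨ cong (λ l → l * suc L + 1) (length-tabulate {n = n} (λ v → v)) ⟩
      n * suc L + 1                        ≤⟨ +-monoˡ-≤ 1 (*-monoˡ-≤ (suc L) n≤L) ⟩
      L * suc L + 1                        ∎
      where open ≤-Reasoning

    weighted≡ : encodeGraph graph ++ numerals (tally order js) ++ [ semicolon ] ≡ encodeWeightedGraph weighted
    weighted≡ = cong (λ w → encodeGraph graph ++ w ++ [ semicolon ])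
      (trans (cong numerals (tally-occurrences order js)) (concatMap-map _ (λ v → occurrences (toℕ v) js) (allFin order)))

    weighted≤ : length (encodeWeightedGraph weighted) ≤ listBound L
    weighted≤ = begin
      length (encodeWeightedGraph weighted)  ≡⟨ length-++ (encodeGraph graph) ⟩
      length (encodeGraph graph) + _         ≤⟨ +-mono-≤ graph≤L (list≤ _ order≤L λ v →
                                                  ≤-trans (length-binary _) (≤-trans (occurrences≤ (toℕ v) js) js≤L)) ⟩
      listBound L                            ∎
      where open ≤-Reasoning

  reduction-solves : ∀ {k} (c : Program (suc k)) a d {b} → reductionCost a d L ≤ b →
    (∃[ K ] WeightedGraph.IsMaximumWeightClique weighted K ×
      (∃[ t ] ∃[ ρ ] c ⊢ initial (encodeWeightedGraph weighted) ⇓[ t ] ρ × output ρ ≡ encodeSubset K ×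
        t ≤ a * length (encodeWeightedGraph weighted) ^ d + a)) →
    ∃[ μ ] IsOptimal μ ×
      (∃[ t ] ∃[ ρ ] reduction c ⊢ initial (encodePebbleInstance I) ⇓[ t ] ρ ×
        output ρ ≡ encodeList (λ p → encodeVertex (μ p)) (allFin pebbles) × t ≤ b)
  -- Matching the output equation with `refl` puts `encodeSubset K` on the solver's first stack; `ρ`
  -- is whatever it leaves on the others.
  reduction-solves {k} c a d cost≤b (K , max , t , _ ∷ ρ , r , refl , t≤) =
    placement max , placement-optimal max , time total , _ , run total , refl , ≤-trans (time≤ total) cost≤b
    where
    open _⊢_⇓≤[_]_

    parsed : ℕ → Store (9 + k)
    parsed n = unaries js ∷ (encodeGraph graph ʳ++ []) ∷ ones n ∷ unaries js ∷ [] ∷ [] ∷ [] ∷ [] ∷ initial []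

    saved : Store (suc k) → Store (9 + k)
    saved ρ = [] ∷ [] ∷ [] ∷ unaries js ∷ [] ∷ [] ∷ [] ∷ [] ∷ ρ

    final : Stack → Store (9 + k)
    final w = w ∷ [] ∷ [] ∷ [] ∷ ones (firstInside K) ∷ [] ∷ [] ∷ [] ∷ encodeSubset K ∷ ρ

    input-run : parse ⊢ initial (encodePebbleInstance I) ⇓≤[ parseCost L ] parsed order
    input-run = subst₂ (λ w n → parse ⊢ initial w ⇓≤[ parseCost L ] parsed n)
      input≡ (length-tabulate {n = order} (λ v → v))
      (parse-run _ (λ u → bits-All (adjacent u) (allFin order)) (allFin order) js (≤-reflexive (cong length input≡)))

    tally-run : tallyAll ⊢ parsed order ⇓≤[ tallyAllCost L (listBound L) ]
                saved (initial (encodeWeightedGraph weighted))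
    tally-run = subst (λ w → tallyAll ⊢ parsed order ⇓≤[ tallyAllCost L (listBound L) ] saved (initial w))
      weighted≡
      (tallyAll-run order (encodeGraph graph) js order≤L js≤L
        (subst (λ w → length w ≤ listBound L) (sym weighted≡) weighted≤))

    solver-run : liftBy 8 c ⊢ saved (initial (encodeWeightedGraph weighted)) ⇓≤[ a * listBound L ^ d + a ]
                 saved (encodeSubset K ∷ ρ)
    solver-run = liftBy-run ([] ∷ [] ∷ [] ∷ unaries js ∷ [] ∷ [] ∷ [] ∷ [] ∷ []) r within
      ≤-trans t≤ (+-monoˡ-≤ a (*-monoʳ-≤ a (^-monoˡ-≤ d weighted≤)))

    output≡ : unaries (map (endVertex K) starts) ++ [ semicolon ] ≡
              encodeList (λ p → encodeVertex (placement max p)) (allFin pebbles)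
    output≡ = begin
      unaries (map (endVertex K) starts) ++ [ semicolon ]
        ≡⟨ cong (λ ts → unaries ts ++ [ semicolon ]) (map-∘ (allFin pebbles)) ⟨
      unaries (map (λ p → endVertex K (σ p)) (allFin pebbles)) ++ [ semicolon ]
        ≡⟨ cong (λ ts → unaries ts ++ [ semicolon ]) (map-cong (toℕ-placement max) (allFin pebbles)) ⟨
      unaries (map (λ p → toℕ (placement max p)) (allFin pebbles)) ++ [ semicolon ]
        ≡⟨ unaries-map (λ p → toℕ (placement max p)) (allFin pebbles) ⟩
      encodeList (λ p → encodeVertex (placement max p)) (allFin pebbles)
        ∎
      where open ≡-Reasoning

    output≤ : length (encodeList (λ p → encodeVertex (placement max p)) (allFin pebbles)) ≤ listBound L
    output≤ = ≤-trans (list≤ _ pebbles≤L λ p →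
                subst (_≤ L) (sym (length-replicate _)) (≤-trans (toℕ≤n (placement max p)) order≤L)) (m≤n+m _ L)

    output-run : relocate ⊢ saved (encodeSubset K ∷ ρ) ⇓≤[ relocationCost L (listBound L) ]
                 final (encodeList (λ p → encodeVertex (placement max p)) (allFin pebbles))
    output-run = subst (λ w → relocate ⊢ saved (encodeSubset K ∷ ρ) ⇓≤[ relocationCost L (listBound L) ] final w)
      output≡
      (relocate-run K starts
        (≤-trans (≤-reflexive (length-encodeSubset K)) order≤L) (≤-trans (firstInside≤ K) order≤L) js≤L
        (subst (λ w → length w ≤ listBound L) (sym output≡) output≤))

    total : reduction c ⊢ initial (encodePebbleInstance I) ⇓≤[ reductionCost a d L ]
            final (encodeList (λ p → encodeVertex (placement max p)) (allFin pebbles))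
    total = input-run ⨾≤ tally-run ⨾≤ solver-run ⨾≤ output-run

theorem12 : ∀ {ℓ : Level} (𝒞 : Pred Graph ℓ) →
    PolynomialTimeOn MaximumWeightClique (λ W → 𝒞 (WeightedGraph.graph W)) →
    PolynomialTimeOn CliqueNum (λ I → 𝒞 (PebbleInstance.graph I))
theorem12 𝒞 (k , c , a , d , solve) =
  let a′ , d′ , cost≤ = polynomial-bound (reductionCost-polynomial a d) in
  8 + k , reduction c , a′ , d′ , λ I I∈𝒞 →
    -- Only weights are added to the graph, so `I∈𝒞` is also the membership proof for the weighted
    -- instance.
    reduction-solves I c a d (cost≤ (length (encodePebbleInstance I))) (solve (PebbleWeights.weighted I) I∈𝒞)
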